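{- Let $q$ be an odd prime power and $n$ a positive integer. There are constants $C_0,c>0$ (independent of $q$ and $A$) such that for every $A\subset M_n(\mathbb{F}_q)$ with $|A|\ge C_0\, q^{n^2-1}$, \[ \max\{|A+A|,|AA|\} \ge c\,\min\left\{\frac{|A|^2}{q^{n^2-1/2}},\; q^{n^2/2}|A|^{1/2}\right\}.\]
   Context: $M_n(\mathbb{F}_q)$ is the ring of $n\times n$ matrices over $\mathbb{F}_q$; $A+A=\{a+b:a,b\in A\}$ and $AA=\{ab: a,b\in A\}$. -}

module Defs where

open import Data.Nat as ℕ using (ℕ; zero; suc; _^_)
open import Data.Nat.Primality using (Prime)
open import Data.Fin using (Fin)
open import Data.Integer using (+_)
open import Data.Rational as ℚ using (ℚ)
open import Data.List using (List; length; deduplicate; map; concatMap)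
open import Data.Vec as V using (Vec; zipWith; tabulate; lookup; foldr)
open import Data.Vec.Properties using (≡-dec)
open import Data.Product using (Σ; ∃; ∃-syntax; _×_; _,_)
open import Relation.Binary.PropositionalEquality using (_≡_; _≢_)
open import Relation.Binary.Definitions using (DecidableEquality)
open import Algebra.Structures using (IsCommutativeRing)
open import Function.Bundles using (_↔_)

ℕ→ℚ : ℕ → ℚ
ℕ→ℚ k = (+ k) ℚ./ 1

Odd : ℕ → Set
Odd q = ∃[ k ] q ≡ suc (2 ℕ.* k)

IsPrimePower : ℕ → Set
IsPrimePower q = ∃[ p ] ∃[ m ] Prime p × q ≡ p ^ suc m

record FiniteField : Set₁ where
  field
    Carrier  : Set
    _+_ _*_  : Carrier → Carrier → Carrier
    -_       : Carrier → Carrier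
    0# 1#    : Carrier
    isCommutativeRing : IsCommutativeRing _≡_ _+_ _*_ -_ 0# 1#
    0≢1      : 0# ≢ 1#
    inverse  : ∀ x → x ≢ 0# → ∃[ y ] x * y ≡ 1#
    _≟_      : DecidableEquality Carrier
    size     : ℕ
    enum     : Carrier ↔ Fin size

module _ (F : FiniteField) where
  open FiniteField F

  Mat : ℕ → Set
  Mat n = Vec (Vec Carrier n) n

  _≟M_ : ∀ {n} → DecidableEquality (Mat n)
  _≟M_ = ≡-dec (≡-dec _≟_)

  _+M_ : ∀ {n} → Mat n → Mat n → Mat n
  _+M_ = zipWith (zipWith _+_)

  _*M_ : ∀ {n} → Mat n → Mat n → Mat n
  _*M_ {n} a b = tabulate λ i → tabulate λ j →
    foldr (λ _ → Carrier) _+_ 0# (tabulate λ k → lookup (lookup a i) k * lookup (lookup b k) j)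

  -- a finite set of matrices is a duplicate-free list; |A| = length A
  -- the list of all products a ∘ b with a, b ∈ A
  pairwise : ∀ {n} → (Mat n → Mat n → Mat n) → List (Mat n) → List (Mat n)
  pairwise _∘_ A = concatMap (λ a → map (λ b → a ∘ b) A) A

  sumsetSize : ∀ {n} → List (Mat n) → ℕ
  sumsetSize A = length (deduplicate _≟M_ (pairwise _+M_ A))

  prodsetSize : ∀ {n} → List (Mat n) → ℕ
  prodsetSize A = length (deduplicate _≟M_ (pairwise _*M_ A))

{-# OPTIONS --safe #-}
module Submission where

-- Let a = |A|, Q = q^(n²), S = A + A and P = A A, and let A′ ⊆ A be the nonsingular elements of A.
-- There are at most n q^(n²-1) singular matrices, so |A′| ≥ a/2 once a ≥ 2 n q^(n²-1).  The equation
-- (s - b) c = p has the a² |A′| solutions (a + b , b , c , a c) in S × A × A′ × P.  On the other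
-- hand, let f (s , p) be the number of its solutions (b , c) in A × A′.  Over all pairs of matrices,
-- f has mean m / Q with m = a |A′|, and Σ f² counts the solutions of (s - b) c = (s - b′) c′.
-- If c - c′ is nonsingular, b, c, b′, c′ determine s; otherwise s, b′, c′, c determine b (c is
-- nonsingular), and c - c′ lies in the small set of singular matrices.  Hence
-- Σ f² ≤ m² + m Q · n q^(n²-1), and Cauchy–Schwarz on S × P gives |S| |P| ≥ a Q / 2 or
-- 8 |S| |P| · n q^(2n²-1) ≥ a⁴.

open import Defs
open import Algebra.Bundles using (AbelianGroup; CommutativeRing)
open import Algebra.Core using (Op₁; Op₂)
open import Algebra.Definitions using (_DistributesOverˡ_; _DistributesOverʳ_)
open import Algebra.Structures using (IsAbelianGroup)
import Algebra.Properties.AbelianGroup as AbelianGroupProperties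
import Algebra.Properties.Semiring.Sum as SemiringSum
open import Data.Empty using (⊥-elim)
open import Data.Fin using (Fin; punchIn)
import Data.Fin.Properties as Fin
import Data.Integer as ℤ
import Data.Integer.Properties as ℤ
open import Data.List using (List; []; _∷_; _++_; length; map; filter; deduplicate; allFin;
                             cartesianProduct; cartesianProductWith)
open import Data.List.Properties using (length-map; length-++; length-tabulate)
open import Data.List.Membership.Propositional using (_∈_; _∉_)
open import Data.List.Membership.Propositional.Properties
import Data.List.Membership.DecPropositional as DecMembership
open import Data.List.Relation.Unary.All as All using ([]; _∷_)
open import Data.List.Relation.Unary.AllPairs using ([]; _∷_)
open import Data.List.Relation.Unary.Any as Any using (here; there)
open import Data.List.Relation.Unary.Unique.Propositional using (Unique)
import Data.List.Relation.Unary.Unique.Propositional.Properties as Unique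
import Data.List.Relation.Unary.Unique.DecPropositional.Properties as DecUnique
open import Data.Nat as ℕ using (ℕ; zero; suc; _^_; _∸_; z≤n; s≤s)
open import Data.Nat.ListAction using (sum)
import Data.Nat.Properties as ℕ
open import Data.Nat.Tactic.RingSolver using (solve-∀)
open import Data.Product using (∃-syntax; _×_; _,_; proj₁; proj₂)
import Data.Product.Properties as Product
import Data.Rational.Properties as ℚ
open import Data.Rational.Unnormalised as ℚᵘ using (mkℚᵘ; *≤*; *≡*)
import Data.Rational.Unnormalised.Properties as ℚᵘ
open import Data.Sum as Sum using (_⊎_; inj₁; inj₂)
open import Data.Vec as Vec using (Vec; []; _∷_; lookup; insertAt; removeAt; tabulate; zipWith)
import Data.Vec.Properties as Vec
open import Function using (_∘_; id)
open import Function.Bundles using (Inverse)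
open import Relation.Binary.Definitions using (DecidableEquality)
open import Relation.Binary.PropositionalEquality
open import Relation.Nullary using (Dec; yes; no; ¬_; ¬?)
open import Relation.Unary using (Pred; Decidable)

-- Sums over lists

∑ : {A : Set} → List A → (A → ℕ) → ℕ
∑ xs f = sum (map f xs)

syntax ∑ xs (λ x → e) = ∑[ x ∈ xs ] e

𝟙 : {P : Set} → Dec P → ℕ
𝟙 (yes _) = 1
𝟙 (no _)  = 0

module _ {A : Set} where

  ∑-mono-∈ : (xs : List A) {f g : A → ℕ} → (∀ x → x ∈ xs → f x ℕ.≤ g x) → ∑ xs f ℕ.≤ ∑ xs g
  ∑-mono-∈ []       _  = z≤n
  ∑-mono-∈ (x ∷ xs) le = ℕ.+-mono-≤ (le x (here refl)) (∑-mono-∈ xs (λ y y∈ → le y (there y∈)))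

  ∑-mono : (xs : List A) {f g : A → ℕ} → (∀ x → f x ℕ.≤ g x) → ∑ xs f ℕ.≤ ∑ xs g
  ∑-mono xs le = ∑-mono-∈ xs (λ x _ → le x)

  ∑-cong : (xs : List A) {f g : A → ℕ} → (∀ x → f x ≡ g x) → ∑ xs f ≡ ∑ xs g
  ∑-cong []       _  = refl
  ∑-cong (x ∷ xs) eq = cong₂ ℕ._+_ (eq x) (∑-cong xs eq)

  ∑-+ : (xs : List A) (f g : A → ℕ) → ∑[ x ∈ xs ] (f x ℕ.+ g x) ≡ ∑ xs f ℕ.+ ∑ xs g
  ∑-+ []       f g = refl
  ∑-+ (x ∷ xs) f g = trans (cong (f x ℕ.+ g x ℕ.+_) (∑-+ xs f g)) (shuffle (f x) (g x) _ _)
    where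
    shuffle : ∀ a b c d → a ℕ.+ b ℕ.+ (c ℕ.+ d) ≡ a ℕ.+ c ℕ.+ (b ℕ.+ d)
    shuffle = solve-∀

  ∑-*ˡ : (k : ℕ) (xs : List A) (f : A → ℕ) → ∑[ x ∈ xs ] (k ℕ.* f x) ≡ k ℕ.* ∑ xs f
  ∑-*ˡ k []       f = sym (ℕ.*-zeroʳ k)
  ∑-*ˡ k (x ∷ xs) f = trans (cong (k ℕ.* f x ℕ.+_) (∑-*ˡ k xs f)) (sym (ℕ.*-distribˡ-+ k (f x) _))

  ∑-*ʳ : (k : ℕ) (xs : List A) (f : A → ℕ) → ∑[ x ∈ xs ] (f x ℕ.* k) ≡ ∑ xs f ℕ.* k
  ∑-*ʳ k xs f = trans (∑-cong xs (λ x → ℕ.*-comm (f x) k)) (trans (∑-*ˡ k xs f) (ℕ.*-comm k _))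

  ∑-const : (xs : List A) (k : ℕ) → ∑[ _ ∈ xs ] k ≡ length xs ℕ.* k
  ∑-const []       k = refl
  ∑-const (x ∷ xs) k = cong (k ℕ.+_) (∑-const xs k)

  ∑-++ : (xs ys : List A) (f : A → ℕ) → ∑ (xs ++ ys) f ≡ ∑ xs f ℕ.+ ∑ ys f
  ∑-++ []       ys f = refl
  ∑-++ (x ∷ xs) ys f = trans (cong (f x ℕ.+_) (∑-++ xs ys f)) (sym (ℕ.+-assoc (f x) _ _))

module _ {A B : Set} where

  ∑-map : (g : A → B) (xs : List A) (f : B → ℕ) → ∑ (map g xs) f ≡ ∑ xs (f ∘ g)
  ∑-map g []       f = refl
  ∑-map g (x ∷ xs) f = cong (f (g x) ℕ.+_) (∑-map g xs f)

  ∑-comm : (xs : List A) (ys : List B) (f : A → B → ℕ) →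
           ∑[ x ∈ xs ] ∑[ y ∈ ys ] f x y ≡ ∑[ y ∈ ys ] ∑[ x ∈ xs ] f x y
  ∑-comm []       ys f = sym (trans (∑-const ys 0) (ℕ.*-zeroʳ (length ys)))
  ∑-comm (x ∷ xs) ys f = trans (cong (∑ ys (f x) ℕ.+_) (∑-comm xs ys f)) (sym (∑-+ ys (f x) _))

module _ {A B : Set} where

  ∑-*-∑ : (xs : List A) (ys : List B) (f : A → ℕ) (g : B → ℕ) →
          ∑ xs f ℕ.* ∑ ys g ≡ ∑[ x ∈ xs ] ∑[ y ∈ ys ] (f x ℕ.* g y)
  ∑-*-∑ xs ys f g = trans (sym (∑-*ʳ (∑ ys g) xs f)) (∑-cong xs (λ x → sym (∑-*ˡ (f x) ys g)))

  ∑-× : (xs : List A) (ys : List B) (f : A × B → ℕ) →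
        ∑ (cartesianProduct xs ys) f ≡ ∑[ x ∈ xs ] ∑[ y ∈ ys ] f (x , y)
  ∑-× []       ys f = refl
  ∑-× (x ∷ xs) ys f = trans (∑-++ (map (x ,_) ys) _ f)
                            (cong₂ ℕ._+_ (∑-map (x ,_) ys f) (∑-× xs ys f))

-- Squares and the Cauchy-Schwarz inequality

2xy≤x²+y² : ∀ x y → 2 ℕ.* (x ℕ.* y) ℕ.≤ x ℕ.* x ℕ.+ y ℕ.* y
2xy≤x²+y² x y with ℕ.≤-total x y
-- With the larger number written as the smaller plus k, the two sides differ by exactly k².
... | inj₁ x≤y with k , refl ← ℕ.m≤n⇒∃[o]m+o≡n x≤y =
  ℕ.≤-trans (ℕ.m≤m+n _ (k ℕ.* k)) (ℕ.≤-reflexive (gap x k))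
  where
  gap : ∀ x k → 2 ℕ.* (x ℕ.* (x ℕ.+ k)) ℕ.+ k ℕ.* k ≡ x ℕ.* x ℕ.+ (x ℕ.+ k) ℕ.* (x ℕ.+ k)
  gap = solve-∀
... | inj₂ y≤x with k , refl ← ℕ.m≤n⇒∃[o]m+o≡n y≤x =
  ℕ.≤-trans (ℕ.m≤m+n _ (k ℕ.* k)) (ℕ.≤-reflexive (gap y k))
  where
  gap : ∀ y k → 2 ℕ.* ((y ℕ.+ k) ℕ.* y) ℕ.+ k ℕ.* k ≡ (y ℕ.+ k) ℕ.* (y ℕ.+ k) ℕ.+ y ℕ.* y
  gap = solve-∀

-- Expands (x - y)² when y ≤ x; otherwise x ∸ y = 0.
[x∸y]²+2xy≤x²+y² : ∀ x y → (x ∸ y) ℕ.* (x ∸ y) ℕ.+ 2 ℕ.* (x ℕ.* y) ℕ.≤ x ℕ.* x ℕ.+ y ℕ.* y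
[x∸y]²+2xy≤x²+y² x y with ℕ.≤-total x y
... | inj₁ x≤y rewrite ℕ.m≤n⇒m∸n≡0 x≤y = 2xy≤x²+y² x y
... | inj₂ y≤x with k , refl ← ℕ.m≤n⇒∃[o]m+o≡n y≤x
  rewrite ℕ.m+n∸m≡n y k = ℕ.≤-reflexive (identity y k)
  where
  identity : ∀ y k → k ℕ.* k ℕ.+ 2 ℕ.* ((y ℕ.+ k) ℕ.* y) ≡ (y ℕ.+ k) ℕ.* (y ℕ.+ k) ℕ.+ y ℕ.* y
  identity = solve-∀

module _ {A : Set} where

  -- Sum 2 (f x) (f y) ≤ (f x)² + (f y)² over all pairs.
  ∑-Cauchy-Schwarz : (xs : List A) (f : A → ℕ) →
                     ∑ xs f ℕ.* ∑ xs f ℕ.≤ length xs ℕ.* ∑[ x ∈ xs ] (f x ℕ.* f x)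
  ∑-Cauchy-Schwarz xs f = ℕ.*-cancelˡ-≤ 2 (begin
    2 ℕ.* (∑ xs f ℕ.* ∑ xs f)
      ≡⟨ cong (2 ℕ.*_) (∑-*-∑ xs xs f f) ⟩
    2 ℕ.* (∑[ x ∈ xs ] ∑[ y ∈ xs ] (f x ℕ.* f y))
      ≡⟨ trans (sym (∑-*ˡ 2 xs _)) (∑-cong xs (λ x → sym (∑-*ˡ 2 xs _))) ⟩
    (∑[ x ∈ xs ] ∑[ y ∈ xs ] (2 ℕ.* (f x ℕ.* f y)))
      ≤⟨ ∑-mono xs (λ x → ∑-mono xs (λ y → 2xy≤x²+y² (f x) (f y))) ⟩
    (∑[ x ∈ xs ] ∑[ y ∈ xs ] (f x ℕ.* f x ℕ.+ f y ℕ.* f y))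
      ≡⟨ ∑-cong xs (λ x → trans (∑-+ xs _ _) (cong (ℕ._+ S) (∑-const xs _))) ⟩
    (∑[ x ∈ xs ] (length xs ℕ.* (f x ℕ.* f x) ℕ.+ S))
      ≡⟨ trans (∑-+ xs _ _) (cong₂ ℕ._+_ (∑-*ˡ (length xs) xs _) (∑-const xs S)) ⟩
    length xs ℕ.* S ℕ.+ length xs ℕ.* S
      ≡⟨ cong (length xs ℕ.* S ℕ.+_) (sym (ℕ.+-identityʳ _)) ⟩
    2 ℕ.* (length xs ℕ.* S) ∎)
    where
    open ℕ.≤-Reasoning
    S = ∑[ x ∈ xs ] (f x ℕ.* f x)

  length-filter-¬ : {P : Pred A _} (P? : Decidable P) (xs : List A) →
                    length (filter (¬? ∘ P?) xs) ℕ.+ ∑[ x ∈ xs ] 𝟙 (P? x) ≡ length xs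
  length-filter-¬ P? [] = refl
  length-filter-¬ P? (x ∷ xs) with P? x
  ... | yes _ = trans (ℕ.+-suc _ _) (cong suc (length-filter-¬ P? xs))
  ... | no  _ = cong suc (length-filter-¬ P? xs)

  ∑𝟙≡0 : {P : Pred A _} (P? : Decidable P) (xs : List A) → (∀ x → x ∈ xs → ¬ P x) →
         ∑[ x ∈ xs ] 𝟙 (P? x) ≡ 0
  ∑𝟙≡0 P? []       _  = refl
  ∑𝟙≡0 P? (x ∷ xs) ¬p with P? x
  ... | yes p = ⊥-elim (¬p x (here refl) p)
  ... | no  _ = ∑𝟙≡0 P? xs (λ y y∈ → ¬p y (there y∈))

  -- This is how "the equation has at most one solution" enters the counts: after one hit, `Unique`
  -- excludes any later entry satisfying P.
  ∑𝟙≤1 : {P : Pred A _} (P? : Decidable P) {xs : List A} → Unique xs →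
         (∀ {x y} → P x → P y → x ≡ y) → ∑[ x ∈ xs ] 𝟙 (P? x) ℕ.≤ 1
  ∑𝟙≤1 P? []                    _  = z≤n
  ∑𝟙≤1 P? {x ∷ xs} (x∉xs ∷ uniq) pp with P? x
  ... | no  _ = ∑𝟙≤1 P? uniq pp
  ... | yes p = s≤s (ℕ.≤-reflexive (∑𝟙≡0 P? xs λ y y∈ py →
                  All.lookup x∉xs y∈ (pp p py)))

-- Counting by injections

module _ {B : Set} (_≟_ : DecidableEquality B) where

  -- The term at an occurrence of b already equals h b. Only an inequality holds, because ys may
  -- contain repetitions.
  ∑-hit : {ys : List B} (h : B → ℕ) {b : B} → b ∈ ys → h b ℕ.≤ ∑[ y ∈ ys ] (𝟙 (b ≟ y) ℕ.* h y)
  ∑-hit h {b} (here refl) with b ≟ b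
  ... | yes _  = ℕ.≤-trans (ℕ.≤-reflexive (sym (ℕ.*-identityˡ (h b)))) (ℕ.m≤m+n _ _)
  ... | no b≢b = ⊥-elim (b≢b refl)
  ∑-hit h (there b∈) = ℕ.≤-trans (∑-hit h b∈) (ℕ.m≤n+m _ _)

  ∑-hit-1 : {ys : List B} {b : B} → b ∈ ys → 1 ℕ.≤ ∑[ y ∈ ys ] 𝟙 (b ≟ y)
  ∑-hit-1 {ys} b∈ = ℕ.≤-trans (∑-hit (λ _ → 1) b∈)
                              (ℕ.≤-reflexive (∑-cong ys (λ y → ℕ.*-identityʳ _)))

module _ {A B : Set} (_≟_ : DecidableEquality B) where

  -- Double counting: after the two sums are exchanged, each y is the image of at most one entry of
  -- xs. The pointwise hypothesis asks for a hit in ys only where f x is positive, which allows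
  -- indicators as f.
  ∑-injection : {xs : List A} (ys : List B) (g : A → B) {f : A → ℕ} (h : B → ℕ) →
                Unique xs → (∀ {x y} → g x ≡ g y → x ≡ y) →
                (∀ x → x ∈ xs → f x ℕ.≤ ∑[ y ∈ ys ] (𝟙 (g x ≟ y) ℕ.* h y)) →
                ∑ xs f ℕ.≤ ∑ ys h
  ∑-injection {xs} ys g {f} h uniq g-inj f≤ = begin
    ∑ xs f                                         ≤⟨ ∑-mono-∈ xs f≤ ⟩
    ∑[ x ∈ xs ] ∑[ y ∈ ys ] (𝟙 (g x ≟ y) ℕ.* h y)  ≡⟨ ∑-comm xs ys _ ⟩
    ∑[ y ∈ ys ] ∑[ x ∈ xs ] (𝟙 (g x ≟ y) ℕ.* h y)  ≡⟨ ∑-cong ys (λ y → ∑-*ʳ (h y) xs _) ⟩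
    ∑[ y ∈ ys ] ((∑[ x ∈ xs ] 𝟙 (g x ≟ y)) ℕ.* h y)
      ≤⟨ ∑-mono ys (λ y → ℕ.*-monoˡ-≤ (h y) (∑𝟙≤1 (λ x → g x ≟ y) uniq
           (λ p q → g-inj (trans p (sym q))))) ⟩
    ∑[ y ∈ ys ] (1 ℕ.* h y)                        ≡⟨ ∑-cong ys (λ y → ℕ.*-identityˡ (h y)) ⟩
    ∑ ys h                                         ∎
    where open ℕ.≤-Reasoning

length-cartesianProductWith : {A B C : Set} (f : A → B → C) (xs : List A) (ys : List B) →
  length (cartesianProductWith f xs ys) ≡ length xs ℕ.* length ys
length-cartesianProductWith f []       ys = refl
length-cartesianProductWith f (x ∷ xs) ys =
  trans (length-++ (map (f x) ys)) (cong₂ ℕ._+_ (length-map (f x) ys) (length-cartesianProductWith f xs ys))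

-- If f has mean at least m / Q on W and variance at most e / Q², then its sum over P cannot exceed
-- the expected |P| m / Q by much.  Clearing denominators and truncating the deviation Q f - m at 0
-- keeps everything in ℕ.
deviation-bound : {A : Set} (P W : List A) (f : A → ℕ) (Q m e : ℕ) →
  (∀ h → ∑ P h ℕ.≤ ∑ W h) → length W ≡ Q ℕ.* Q → Q ℕ.* m ℕ.≤ ∑ W f →
  ∑[ w ∈ W ] (f w ℕ.* f w) ℕ.≤ m ℕ.* m ℕ.+ e →
  ∃[ G ] (Q ℕ.* ∑ P f ℕ.≤ G ℕ.+ m ℕ.* length P × G ℕ.* G ℕ.≤ length P ℕ.* (Q ℕ.* Q ℕ.* e))
-- Cauchy-Schwarz is applied on P alone; the sum of squares is then enlarged from P to W, where the
-- second moment is known.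
deviation-bound P W f Q m e P≤W |W| mean moment = ∑ P g , excess , ℕ.≤-trans (∑-Cauchy-Schwarz P g)
    (ℕ.*-monoʳ-≤ (length P) (ℕ.≤-trans (P≤W g²) variance))
  where
  open ℕ.≤-Reasoning
  g g² : _ → ℕ
  g  w = Q ℕ.* f w ∸ m
  g² w = g w ℕ.* g w

  excess : Q ℕ.* ∑ P f ℕ.≤ ∑ P g ℕ.+ m ℕ.* length P
  excess = begin
    Q ℕ.* ∑ P f                  ≡⟨ ∑-*ˡ Q P f ⟨
    ∑[ w ∈ P ] (Q ℕ.* f w)       ≤⟨ ∑-mono P (λ w → ℕ.m≤n+m∸n (Q ℕ.* f w) m) ⟩
    ∑[ w ∈ P ] (m ℕ.+ g w)       ≡⟨ ∑-+ P _ g ⟩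
    (∑[ _ ∈ P ] m) ℕ.+ ∑ P g     ≡⟨ cong (ℕ._+ ∑ P g) (trans (∑-const P m) (ℕ.*-comm (length P) m)) ⟩
    m ℕ.* length P ℕ.+ ∑ P g     ≡⟨ ℕ.+-comm _ (∑ P g) ⟩
    ∑ P g ℕ.+ m ℕ.* length P     ∎

  regroup₁ : ∀ Q m e → Q ℕ.* Q ℕ.* (m ℕ.* m ℕ.+ e) ℕ.+ Q ℕ.* Q ℕ.* (m ℕ.* m)
                     ≡ Q ℕ.* Q ℕ.* e ℕ.+ 2 ℕ.* (Q ℕ.* m) ℕ.* (Q ℕ.* m)
  regroup₁ = solve-∀
  regroup₂ : ∀ Q m x → 2 ℕ.* (Q ℕ.* m) ℕ.* x ≡ 2 ℕ.* (Q ℕ.* x ℕ.* m)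
  regroup₂ = solve-∀
  regroup₃ : ∀ Q x → Q ℕ.* x ℕ.* (Q ℕ.* x) ≡ Q ℕ.* Q ℕ.* (x ℕ.* x)
  regroup₃ = solve-∀

  variance : ∑ W g² ℕ.≤ Q ℕ.* Q ℕ.* e
  -- The cross term is added to both sides instead of being subtracted. It then stands on the
  -- smaller side, so a lower bound on the sum of f is what is required.
  variance = ℕ.+-cancelʳ-≤ (2 ℕ.* (Q ℕ.* m) ℕ.* (Q ℕ.* m)) _ _ (begin
    ∑ W g² ℕ.+ 2 ℕ.* (Q ℕ.* m) ℕ.* (Q ℕ.* m)
      ≤⟨ ℕ.+-monoʳ-≤ (∑ W g²) (ℕ.*-monoʳ-≤ (2 ℕ.* (Q ℕ.* m)) mean) ⟩
    ∑ W g² ℕ.+ 2 ℕ.* (Q ℕ.* m) ℕ.* ∑ W f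
      ≡⟨ cong (∑ W g² ℕ.+_) (trans (sym (∑-*ˡ (2 ℕ.* (Q ℕ.* m)) W f)) (∑-cong W (λ w → regroup₂ Q m (f w)))) ⟩
    ∑ W g² ℕ.+ (∑[ w ∈ W ] (2 ℕ.* (Q ℕ.* f w ℕ.* m)))
      ≡⟨ ∑-+ W g² _ ⟨
    ∑[ w ∈ W ] (g² w ℕ.+ 2 ℕ.* (Q ℕ.* f w ℕ.* m))
      ≤⟨ ∑-mono W (λ w → [x∸y]²+2xy≤x²+y² (Q ℕ.* f w) m) ⟩
    ∑[ w ∈ W ] (Q ℕ.* f w ℕ.* (Q ℕ.* f w) ℕ.+ m ℕ.* m)
      ≡⟨ ∑-+ W _ _ ⟩
    ∑[ w ∈ W ] (Q ℕ.* f w ℕ.* (Q ℕ.* f w)) ℕ.+ ∑[ _ ∈ W ] (m ℕ.* m)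
      ≡⟨ cong₂ ℕ._+_ (trans (∑-cong W (λ w → regroup₃ Q (f w))) (∑-*ˡ (Q ℕ.* Q) W _))
                     (trans (∑-const W _) (cong (ℕ._* (m ℕ.* m)) |W|)) ⟩
    Q ℕ.* Q ℕ.* (∑[ w ∈ W ] (f w ℕ.* f w)) ℕ.+ Q ℕ.* Q ℕ.* (m ℕ.* m)
      ≤⟨ ℕ.+-monoˡ-≤ _ (ℕ.*-monoʳ-≤ (Q ℕ.* Q) moment) ⟩
    Q ℕ.* Q ℕ.* (m ℕ.* m ℕ.+ e) ℕ.+ Q ℕ.* Q ℕ.* (m ℕ.* m)
      ≡⟨ regroup₁ Q m e ⟩
    Q ℕ.* Q ℕ.* e ℕ.+ 2 ℕ.* (Q ℕ.* m) ℕ.* (Q ℕ.* m) ∎)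

-- The incidence bound

-- From Q a² a′ ≤ G + a a′ τ: either the main term a a′ τ carries half of the left side, or G does.
main-or-error-term : ∀ a a′ Q τ l G → a ℕ.≤ 2 ℕ.* a′ →
  Q ℕ.* (a ℕ.* (a ℕ.* a′)) ℕ.≤ G ℕ.+ a ℕ.* a′ ℕ.* τ →
  G ℕ.* G ℕ.≤ τ ℕ.* (Q ℕ.* Q ℕ.* (Q ℕ.* (a ℕ.* a′ ℕ.* l))) →
  Q ℕ.* a ℕ.≤ 2 ℕ.* τ ⊎ a ^ 4 ℕ.≤ 8 ℕ.* τ ℕ.* (Q ℕ.* l)
-- The zero cases are split off so that Q Q m is visibly nonzero when `core` cancels it: a′ = 0
-- contradicts 1 ≤ a ≤ 2 a′, and Q = 0 would give Q a ≤ 2 τ.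
main-or-error-term zero        a′         Q τ l G _ _ _ = inj₂ z≤n
main-or-error-term a@(suc _) zero Q τ l G a≤ _ _ = ⊥-elim (ℕ.<⇒≱ (s≤s z≤n) a≤)
main-or-error-term a@(suc _) a′@(suc _) Q τ l G a≤ incidences G²≤ with Q ℕ.* a ℕ.≤? 2 ℕ.* τ
... | yes Qa≤2τ = inj₁ Qa≤2τ
... | no  Qa≰2τ with Q
...   | zero = ⊥-elim (Qa≰2τ z≤n)
...   | Q@(suc _) = inj₂ (begin
    a ^ 4                              ≡⟨ power a ⟩
    a ℕ.* (a ℕ.* (a ℕ.* a))            ≤⟨ ℕ.*-monoˡ-≤ _ a≤ ⟩
    2 ℕ.* a′ ℕ.* (a ℕ.* (a ℕ.* a))     ≡⟨ regroup₁ a a′ ⟩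
    2 ℕ.* (a ℕ.* (a ℕ.* m))            ≤⟨ ℕ.*-monoʳ-≤ 2 core ⟩
    2 ℕ.* (4 ℕ.* τ ℕ.* (Q ℕ.* l))      ≡⟨ regroup₂ τ (Q ℕ.* l) ⟩
    8 ℕ.* τ ℕ.* (Q ℕ.* l)              ∎)
  where
  open ℕ.≤-Reasoning
  m = a ℕ.* a′
  power : ∀ a → a ℕ.* (a ℕ.* (a ℕ.* (a ℕ.* 1))) ≡ a ℕ.* (a ℕ.* (a ℕ.* a))
  power = solve-∀
  regroup₁ : ∀ a a′ → 2 ℕ.* a′ ℕ.* (a ℕ.* (a ℕ.* a)) ≡ 2 ℕ.* (a ℕ.* (a ℕ.* (a ℕ.* a′)))
  regroup₁ = solve-∀
  regroup₂ : ∀ x y → 2 ℕ.* (4 ℕ.* x ℕ.* y) ≡ 8 ℕ.* x ℕ.* y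
  regroup₂ = solve-∀
  regroup₃ : ∀ m τ → 2 ℕ.* (m ℕ.* τ) ≡ m ℕ.* (2 ℕ.* τ)
  regroup₃ = solve-∀
  regroup₄ : ∀ m Q a → m ℕ.* (Q ℕ.* a) ≡ Q ℕ.* (a ℕ.* m)
  regroup₄ = solve-∀
  regroup₅ : ∀ G → 2 ℕ.* G ℕ.* (2 ℕ.* G) ≡ 4 ℕ.* (G ℕ.* G)
  regroup₅ = solve-∀
  regroup₆ : ∀ Q a m → Q ℕ.* Q ℕ.* m ℕ.* (a ℕ.* (a ℕ.* m)) ≡ Q ℕ.* (a ℕ.* m) ℕ.* (Q ℕ.* (a ℕ.* m))
  regroup₆ = solve-∀
  regroup₇ : ∀ τ Q m l → 4 ℕ.* (τ ℕ.* (Q ℕ.* Q ℕ.* (Q ℕ.* (m ℕ.* l))))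
                       ≡ Q ℕ.* Q ℕ.* m ℕ.* (4 ℕ.* τ ℕ.* (Q ℕ.* l))
  regroup₇ = solve-∀

  Qam = Q ℕ.* (a ℕ.* m)

  Qam≤2G : Qam ℕ.≤ 2 ℕ.* G
  -- Since 2 τ < Q a here, the main term m τ is at most half of `Qam`, and G must account for the
  -- other half.
  Qam≤2G = ℕ.+-cancelʳ-≤ Qam _ _ (begin
    Qam ℕ.+ Qam                    ≡⟨ cong (Qam ℕ.+_) (ℕ.+-identityʳ Qam) ⟨
    2 ℕ.* Qam                      ≤⟨ ℕ.*-monoʳ-≤ 2 incidences ⟩
    2 ℕ.* (G ℕ.+ m ℕ.* τ)          ≡⟨ ℕ.*-distribˡ-+ 2 G _ ⟩
    2 ℕ.* G ℕ.+ 2 ℕ.* (m ℕ.* τ)    ≡⟨ cong (2 ℕ.* G ℕ.+_) (regroup₃ m τ) ⟩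
    2 ℕ.* G ℕ.+ m ℕ.* (2 ℕ.* τ)    ≤⟨ ℕ.+-monoʳ-≤ _ (ℕ.*-monoʳ-≤ m (ℕ.<⇒≤ (ℕ.≰⇒> Qa≰2τ))) ⟩
    2 ℕ.* G ℕ.+ m ℕ.* (Q ℕ.* a)    ≡⟨ cong (2 ℕ.* G ℕ.+_) (regroup₄ m Q a) ⟩
    2 ℕ.* G ℕ.+ Qam                ∎)

  core : a ℕ.* (a ℕ.* m) ℕ.≤ 4 ℕ.* τ ℕ.* (Q ℕ.* l)
  -- Squaring `Qam≤2G` brings in the bound on G²; both sides then share the factor Q² m.
  core = ℕ.*-cancelˡ-≤ (Q ℕ.* Q ℕ.* m) (begin
    Q ℕ.* Q ℕ.* m ℕ.* (a ℕ.* (a ℕ.* m))                  ≡⟨ regroup₆ Q a m ⟩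
    Qam ℕ.* Qam                                          ≤⟨ ℕ.*-mono-≤ Qam≤2G Qam≤2G ⟩
    2 ℕ.* G ℕ.* (2 ℕ.* G)                                ≡⟨ regroup₅ G ⟩
    4 ℕ.* (G ℕ.* G)                                      ≤⟨ ℕ.*-monoʳ-≤ 4 G²≤ ⟩
    4 ℕ.* (τ ℕ.* (Q ℕ.* Q ℕ.* (Q ℕ.* (m ℕ.* l))))        ≡⟨ regroup₇ τ Q m l ⟩
    Q ℕ.* Q ℕ.* m ℕ.* (4 ℕ.* τ ℕ.* (Q ℕ.* l))            ∎)

-- The sum-product alternative from right cancellation outside a small list

module SumProduct
  {X : Set} (_≟_ : DecidableEquality X)
  {_+_ _·_ : X → X → X} {0# : X} { -_ : X → X}
  (isAbelianGroup : IsAbelianGroup _≡_ _+_ 0# -_)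
  (distribˡ : _DistributesOverˡ_ _≡_ _·_ _+_)
  (distribʳ : _DistributesOverʳ_ _≡_ _·_ _+_)
  (U : List X) (U-unique : Unique U) (U-complete : ∀ x → x ∈ U)
  -- `L` stands for the singular matrices: every element that fails right cancellation is in it, and
  -- its length governs the error term.
  (L : List X) (·-cancelʳ : ∀ {d} → d ∉ L → ∀ {x y} → x · d ≡ y · d → x ≡ y)
  where

  private
    group : AbelianGroup _ _
    group = record { isAbelianGroup = isAbelianGroup }

  open AbelianGroup group using (_-_; comm; assoc)
  open AbelianGroupProperties group
  open DecMembership _≟_ using (_∈?_)

  -cancelˡ : ∀ x {y z} → x - y ≡ x - z → y ≡ z
  -cancelˡ x eq = ⁻¹-injective (∙-cancelˡ x _ _ eq)

  -cancelʳ : ∀ z {x y} → x - z ≡ y - z → x ≡ y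
  -cancelʳ z = ∙-cancelʳ (- z) _ _

  -- Expanding both products and collecting the multiples of s isolates s · (c - c′). Adding (s - b)
  -- · c to both sides and cancelling it at the end avoids products with negatives.
  s·[c-c′] : ∀ s {b c b′ c′} → (s - b) · c ≡ (s - b′) · c′ → (s · (c - c′)) + (b′ · c′) ≡ b · c
  s·[c-c′] s {b} {c} {b′} {c′} eq = ∙-cancelˡ ((s - b) · c) _ _ (begin
    ((s - b) · c) + ((s · (c - c′)) + (b′ · c′))   ≡⟨ cong (_+ ((s · (c - c′)) + (b′ · c′))) eq ⟩
    ((s - b′) · c′) + ((s · (c - c′)) + (b′ · c′)) ≡⟨ assoc _ _ _ ⟨
    (((s - b′) · c′) + (s · (c - c′))) + (b′ · c′) ≡⟨ cong (_+ (b′ · c′)) (comm _ _) ⟩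
    ((s · (c - c′)) + ((s - b′) · c′)) + (b′ · c′) ≡⟨ assoc _ _ _ ⟩
    (s · (c - c′)) + (((s - b′) · c′) + (b′ · c′)) ≡⟨ cong ((s · (c - c′)) +_) (split s b′ c′) ⟩
    (s · (c - c′)) + (s · c′)                      ≡⟨ distribˡ s _ _ ⟨
    s · ((c - c′) + c′)                            ≡⟨ cong (s ·_) (//-rightDividesˡ c′ c) ⟩
    s · c                                          ≡⟨ split s b c ⟨
    ((s - b) · c) + (b · c)                        ∎)
    where
    open ≡-Reasoning
    split : ∀ s b c → ((s - b) · c) + (b · c) ≡ s · c
    split s b c = trans (sym (distribʳ c _ b)) (cong (_· c) (//-rightDividesˡ b s))

  -- By `s·[c-c′]`, s · (c - c′) and t · (c - c′) become equal after adding b′ · c′, and c - c′ can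
  -- be cancelled.
  shift-unique : ∀ {s t b c b′ c′} → c - c′ ∉ L →
    (s - b) · c ≡ (s - b′) · c′ → (t - b) · c ≡ (t - b′) · c′ → s ≡ t
  shift-unique {s} {t} c-c′∉L eq-s eq-t =
    ·-cancelʳ c-c′∉L (∙-cancelʳ _ _ _ (trans (s·[c-c′] s eq-s) (sym (s·[c-c′] t eq-t))))

  -- This removes p from the second moment: a nonzero term forces x and y to coincide with p, and p
  -- occurs only once in U.
  ∑-collision : ∀ x y → ∑[ p ∈ U ] (𝟙 (x ≟ p) ℕ.* 𝟙 (y ≟ p)) ℕ.≤ 𝟙 (x ≟ y)
  ∑-collision x y = ℕ.≤-trans (∑-mono U bound) sum≤
    where
    bound : ∀ p → 𝟙 (x ≟ p) ℕ.* 𝟙 (y ≟ p) ℕ.≤ 𝟙 (x ≟ y) ℕ.* 𝟙 (x ≟ p)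
    bound p with x ≟ p | y ≟ p
    ... | no _     | _        = z≤n
    ... | yes _    | no _     = z≤n
    ... | yes refl | yes refl with x ≟ x
    ...   | yes _  = s≤s z≤n
    ...   | no x≢x = ⊥-elim (x≢x refl)
    sum≤ : ∑[ p ∈ U ] (𝟙 (x ≟ y) ℕ.* 𝟙 (x ≟ p)) ℕ.≤ 𝟙 (x ≟ y)
    sum≤ = begin
      ∑[ p ∈ U ] (𝟙 (x ≟ y) ℕ.* 𝟙 (x ≟ p))  ≡⟨ ∑-*ˡ (𝟙 (x ≟ y)) U _ ⟩
      𝟙 (x ≟ y) ℕ.* (∑[ p ∈ U ] 𝟙 (x ≟ p))  ≤⟨ ℕ.*-monoʳ-≤ (𝟙 (x ≟ y)) (∑𝟙≤1 (x ≟_) U-unique (λ p q → trans (sym p) q)) ⟩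
      𝟙 (x ≟ y) ℕ.* 1                       ≡⟨ ℕ.*-identityʳ _ ⟩
      𝟙 (x ≟ y)                             ∎
      where open ℕ.≤-Reasoning

  module _ {A : List X} (A-unique : Unique A) where

    A′ : List X
    A′ = filter (¬? ∘ (_∈? L)) A

    A′-unique : Unique A′
    A′-unique = Unique.filter⁺ (¬? ∘ (_∈? L)) A-unique

    -- Translation by c′ is injective, so the counted c inject into L. It is stated for any B
    -- because both A and `A′` are needed.
    ∑-differences∈L : ∀ {B} → Unique B → ∀ c′ → ∑[ c ∈ B ] 𝟙 ((c - c′) ∈? L) ℕ.≤ length L
    ∑-differences∈L {B} B-unique c′ = begin
      ∑[ c ∈ B ] 𝟙 ((c - c′) ∈? L)  ≤⟨ ∑-injection _≟_ L (_- c′) (λ _ → 1) B-unique (-cancelʳ c′) (λ c _ → hit c) ⟩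
      ∑[ _ ∈ L ] 1                  ≡⟨ ∑-const L 1 ⟩
      length L ℕ.* 1                ≡⟨ ℕ.*-identityʳ _ ⟩
      length L                      ∎
      where
      open ℕ.≤-Reasoning
      hit : ∀ c → 𝟙 ((c - c′) ∈? L) ℕ.≤ ∑[ y ∈ L ] (𝟙 ((c - c′) ≟ y) ℕ.* 1)
      hit c with (c - c′) ∈? L
      ... | yes ∈L = ∑-hit _≟_ (λ _ → 1) ∈L
      ... | no  _  = z≤n

    |A|≤|A′|+|L| : length A ℕ.≤ length A′ ℕ.+ length L
    |A|≤|A′|+|L| = begin
      length A                                          ≡⟨ length-filter-¬ (_∈? L) A ⟨
      -- Writing c as c - 0 makes the count of discarded elements the case c′ = 0 of
      -- `∑-differences∈L`.
      length A′ ℕ.+ ∑[ c ∈ A ] 𝟙 (c ∈? L)               ≡⟨ cong (length A′ ℕ.+_) (∑-cong A (λ c → cong (λ d → 𝟙 (d ∈? L)) (-0# c))) ⟨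
      length A′ ℕ.+ ∑[ c ∈ A ] 𝟙 ((c - 0#) ∈? L)        ≤⟨ ℕ.+-monoʳ-≤ (length A′) (∑-differences∈L A-unique 0#) ⟩
      length A′ ℕ.+ length L                            ∎
      where
      open ℕ.≤-Reasoning
      -0# : ∀ c → c - 0# ≡ c
      -0# c = trans (cong (c +_) ε⁻¹≈ε) (AbelianGroup.identityʳ group c)

    Z : List (X × X)
    Z = cartesianProduct A A′

    |Z| : length Z ≡ length A ℕ.* length A′
    |Z| = length-cartesianProductWith _,_ A A′

    φ : X → X × X → X
    φ s (b , c) = (s - b) · c

    incidences : X × X → ℕ
    incidences (s , p) = ∑[ z ∈ Z ] 𝟙 (φ s z ≟ p)

    ∑-incidences : (S P : List X) → ∑ (cartesianProduct S P) incidences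
                                  ≡ ∑[ z ∈ Z ] ∑[ s ∈ S ] ∑[ p ∈ P ] 𝟙 (φ s z ≟ p)
    ∑-incidences S P = begin
      ∑ (cartesianProduct S P) incidences                ≡⟨ ∑-× S P incidences ⟩
      ∑[ s ∈ S ] ∑[ p ∈ P ] ∑[ z ∈ Z ] 𝟙 (φ s z ≟ p)     ≡⟨ ∑-cong S (λ s → ∑-comm P Z _) ⟩
      ∑[ s ∈ S ] ∑[ z ∈ Z ] ∑[ p ∈ P ] 𝟙 (φ s z ≟ p)     ≡⟨ ∑-comm S Z _ ⟩
      ∑[ z ∈ Z ] ∑[ s ∈ S ] ∑[ p ∈ P ] 𝟙 (φ s z ≟ p)     ∎
      where open ≡-Reasoning

    -- Every choice of s and z has its value φ s z in U and so contributes at least 1. Dividing by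
    -- |U|² gives the mean |Z| / |U|.
    mean : length U ℕ.* length Z ℕ.≤ ∑ (cartesianProduct U U) incidences
    mean = begin
      length U ℕ.* length Z           ≡⟨ ℕ.*-comm (length U) (length Z) ⟩
      length Z ℕ.* length U           ≡⟨ ∑-const Z (length U) ⟨
      ∑[ z ∈ Z ] length U             ≡⟨ ∑-cong Z (λ _ → trans (∑-const U 1) (ℕ.*-identityʳ _)) ⟨
      ∑[ z ∈ Z ] ∑[ s ∈ U ] 1         ≤⟨ ∑-mono Z (λ z → ∑-mono U (λ s → ∑-hit-1 _≟_ (U-complete (φ s z)))) ⟩
      ∑[ z ∈ Z ] ∑[ s ∈ U ] ∑[ p ∈ U ] 𝟙 (φ s z ≟ p)  ≡⟨ ∑-incidences U U ⟨
      ∑ (cartesianProduct U U) incidences ∎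
      where open ℕ.≤-Reasoning

    diff∈L? : (z z′ : X × X) → Dec ((proj₂ z - proj₂ z′) ∈ L)
    diff∈L? (_ , c) (_ , c′) = (c - c′) ∈? L

    collision : X → X × X → X × X → ℕ
    collision s z z′ = 𝟙 (φ s z ≟ φ s z′)

    -- The collision equation is solved for s: when c - c′ is outside L, `shift-unique` leaves at
    -- most one s.
    regular-collisions : ∀ z z′ → ∑[ s ∈ U ] (𝟙 (¬? (diff∈L? z z′)) ℕ.* collision s z z′) ℕ.≤ 1
    regular-collisions z z′ with diff∈L? z z′
    ... | yes _ = subst (ℕ._≤ 1) (sym (trans (∑-const U 0) (ℕ.*-zeroʳ (length U)))) z≤n
    ... | no d∉L = subst (ℕ._≤ 1) (sym (∑-cong U (λ s → ℕ.+-identityʳ _)))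
                         (∑𝟙≤1 (λ s → φ s z ≟ φ s z′) U-unique (shift-unique d∉L))

    -- The collision equation is solved for b: each c in `A′` can be cancelled, so s, z′ and c leave
    -- at most one b. What remains is the number of c with c - c′ in L.
    singular-collisions : ∀ s z′ → ∑[ z ∈ Z ] (𝟙 (diff∈L? z z′) ℕ.* collision s z z′) ℕ.≤ length L
    singular-collisions s z′@(b′ , c′) = begin
      ∑[ z ∈ Z ] (𝟙 (diff∈L? z z′) ℕ.* collision s z z′)
        ≡⟨ trans (∑-× A A′ _) (∑-comm A A′ _) ⟩
      ∑[ c ∈ A′ ] ∑[ b ∈ A ] (𝟙 ((c - c′) ∈? L) ℕ.* 𝟙 (((s - b) · c) ≟ φ s z′))
        ≡⟨ ∑-cong A′ (λ c → ∑-*ˡ (𝟙 ((c - c′) ∈? L)) A _) ⟩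
      ∑[ c ∈ A′ ] (𝟙 ((c - c′) ∈? L) ℕ.* (∑[ b ∈ A ] 𝟙 (((s - b) · c) ≟ φ s z′)))
        ≤⟨ ∑-mono-∈ A′ (λ c c∈ → ℕ.*-monoʳ-≤ (𝟙 ((c - c′) ∈? L)) (∑𝟙≤1 (λ b → ((s - b) · c) ≟ φ s z′) A-unique
             (λ p q → -cancelˡ s (·-cancelʳ (proj₂ (∈-filter⁻ (¬? ∘ (_∈? L)) {xs = A} c∈)) (trans p (sym q)))))) ⟩
      ∑[ c ∈ A′ ] (𝟙 ((c - c′) ∈? L) ℕ.* 1)
        ≡⟨ ∑-cong A′ (λ c → ℕ.*-identityʳ _) ⟩
      ∑[ c ∈ A′ ] 𝟙 ((c - c′) ∈? L)
        ≤⟨ ∑-differences∈L A′-unique c′ ⟩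
      length L ∎
      where open ℕ.≤-Reasoning

    second-moment : ∑[ w ∈ cartesianProduct U U ] (incidences w ℕ.* incidences w)
                    ℕ.≤ length Z ℕ.* length Z ℕ.+ length U ℕ.* (length Z ℕ.* length L)
    second-moment = begin
      ∑[ w ∈ cartesianProduct U U ] (incidences w ℕ.* incidences w)
        ≡⟨ ∑-× U U _ ⟩
      ∑[ s ∈ U ] ∑[ p ∈ U ] (incidences (s , p) ℕ.* incidences (s , p))
        ≡⟨ ∑-cong U (λ s → ∑-cong U (λ p → ∑-*-∑ Z Z _ _)) ⟩
      ∑[ s ∈ U ] ∑[ p ∈ U ] ∑[ z ∈ Z ] ∑[ z′ ∈ Z ] (𝟙 (φ s z ≟ p) ℕ.* 𝟙 (φ s z′ ≟ p))
        ≡⟨ ∑-cong U (λ s → trans (∑-comm U Z _) (∑-cong Z (λ z → ∑-comm U Z _))) ⟩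
      ∑[ s ∈ U ] ∑[ z ∈ Z ] ∑[ z′ ∈ Z ] ∑[ p ∈ U ] (𝟙 (φ s z ≟ p) ℕ.* 𝟙 (φ s z′ ≟ p))
        ≤⟨ ∑-mono U (λ s → ∑-mono Z (λ z → ∑-mono Z (λ z′ →
             ℕ.≤-trans (∑-collision (φ s z) (φ s z′)) (split (diff∈L? z z′) _)))) ⟩
      ∑[ s ∈ U ] ∑[ z ∈ Z ] ∑[ z′ ∈ Z ] (regular s z z′ ℕ.+ singular s z z′)
        ≡⟨ trans (∑-cong U (λ s → trans (∑-cong Z (λ z → ∑-+ Z _ _)) (∑-+ Z _ _))) (∑-+ U _ _) ⟩
      (∑[ s ∈ U ] ∑[ z ∈ Z ] ∑[ z′ ∈ Z ] regular s z z′) ℕ.+ (∑[ s ∈ U ] ∑[ z ∈ Z ] ∑[ z′ ∈ Z ] singular s z z′)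
        -- The two parts are summed in different orders: the regular part with s innermost, the
        -- singular part with z innermost, each matching the variable solved for.
        ≡⟨ cong₂ ℕ._+_ (trans (∑-comm U Z _) (∑-cong Z (λ z → ∑-comm U Z _)))
                       (∑-cong U (λ s → ∑-comm Z Z _)) ⟩
      (∑[ z ∈ Z ] ∑[ z′ ∈ Z ] ∑[ s ∈ U ] regular s z z′) ℕ.+ (∑[ s ∈ U ] ∑[ z′ ∈ Z ] ∑[ z ∈ Z ] singular s z z′)
        ≤⟨ ℕ.+-mono-≤ (∑-mono Z (λ z → ∑-mono Z (regular-collisions z)))
                      (∑-mono U (λ s → ∑-mono Z (singular-collisions s))) ⟩
      (∑[ z ∈ Z ] ∑[ z′ ∈ Z ] 1) ℕ.+ (∑[ s ∈ U ] ∑[ z′ ∈ Z ] length L)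
        ≡⟨ cong₂ ℕ._+_ (trans (∑-const Z _) (cong (length Z ℕ.*_) (trans (∑-const Z 1) (ℕ.*-identityʳ _))))
                       (trans (∑-const U _) (cong (length U ℕ.*_) (∑-const Z _))) ⟩
      length Z ℕ.* length Z ℕ.+ length U ℕ.* (length Z ℕ.* length L) ∎
      where
      open ℕ.≤-Reasoning
      regular singular : X → X × X → X × X → ℕ
      regular  s z z′ = 𝟙 (¬? (diff∈L? z z′)) ℕ.* collision s z z′
      singular s z z′ = 𝟙 (diff∈L? z z′) ℕ.* collision s z z′
      split : {P : Set} (P? : Dec P) (k : ℕ) → k ℕ.≤ 𝟙 (¬? P?) ℕ.* k ℕ.+ 𝟙 P? ℕ.* k
      split (yes _) k = ℕ.≤-reflexive (sym (ℕ.+-identityʳ k))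
      split (no _)  k = ℕ.≤-reflexive (sym (trans (ℕ.+-identityʳ _) (ℕ.+-identityʳ k)))

    -- The deviation bound is applied to S × P inside U × U with Q = |U|, m = |Z| and e = |U| |Z|
    -- |L|; `main-or-error-term` with τ = |S| |P| then separates the two outcomes.
    sum-product : (S P : List X) → Unique S → Unique P →
      (∀ {x y} → x ∈ A → y ∈ A → x + y ∈ S) → (∀ {x y} → x ∈ A → y ∈ A → x · y ∈ P) →
      2 ℕ.* length L ℕ.≤ length A →
      length U ℕ.* length A ℕ.≤ 2 ℕ.* (length S ℕ.* length P)
        ⊎ length A ^ 4 ℕ.≤ 8 ℕ.* (length S ℕ.* length P) ℕ.* (length U ℕ.* length L)
    sum-product S P S-unique P-unique A+A⊆S A·A⊆P 2l≤a =
      main-or-error-term (length A) (length A′) (length U) (length S ℕ.* length P) (length L) (proj₁ deviation)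
        a≤2a′ (ℕ.≤-trans (ℕ.*-monoʳ-≤ (length U) many) (proj₁ (proj₂ deviation))) (proj₂ (proj₂ deviation))
      where
      open ℕ.≤-Reasoning
      S×P≤U×U : ∀ h → ∑ (cartesianProduct S P) h ℕ.≤ ∑ (cartesianProduct U U) h
      S×P≤U×U h = ∑-injection (Product.≡-dec _≟_ _≟_) (cartesianProduct U U) (λ w → w) h
        (Unique.cartesianProduct⁺ S-unique P-unique) (λ eq → eq)
        (λ (s , p) _ → ∑-hit (Product.≡-dec _≟_ _≟_) h
          (∈-cartesianProduct⁺ (U-complete s) (U-complete p)))

      deviation : ∃[ G ]
        ( length U ℕ.* ∑ (cartesianProduct S P) incidences
            ℕ.≤ G ℕ.+ length A ℕ.* length A′ ℕ.* (length S ℕ.* length P)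
        × G ℕ.* G ℕ.≤ length S ℕ.* length P ℕ.*
            (length U ℕ.* length U ℕ.* (length U ℕ.* (length A ℕ.* length A′ ℕ.* length L))) )
      deviation = subst₂
        (λ m τ → ∃[ G ] ( length U ℕ.* ∑ (cartesianProduct S P) incidences ℕ.≤ G ℕ.+ m ℕ.* τ
                        × G ℕ.* G ℕ.≤ τ ℕ.* (length U ℕ.* length U ℕ.* (length U ℕ.* (m ℕ.* length L))) ))
        |Z| (length-cartesianProductWith _,_ S P)
        (deviation-bound (cartesianProduct S P) (cartesianProduct U U) incidences (length U) (length Z) _
          S×P≤U×U (length-cartesianProductWith _,_ U U) mean second-moment)

      a≤2a′ : length A ℕ.≤ 2 ℕ.* length A′
      a≤2a′ = ℕ.+-cancelʳ-≤ (length A) _ _ (begin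
        length A ℕ.+ length A                             ≤⟨ ℕ.+-mono-≤ |A|≤|A′|+|L| |A|≤|A′|+|L| ⟩
        length A′ ℕ.+ length L ℕ.+ (length A′ ℕ.+ length L) ≡⟨ double (length A′) (length L) ⟩
        2 ℕ.* length A′ ℕ.+ 2 ℕ.* length L                ≤⟨ ℕ.+-monoʳ-≤ _ 2l≤a ⟩
        2 ℕ.* length A′ ℕ.+ length A                      ∎)
        where
        double : ∀ x y → x ℕ.+ y ℕ.+ (x ℕ.+ y) ≡ 2 ℕ.* x ℕ.+ 2 ℕ.* y
        double = solve-∀

      many : length A ℕ.* (length A ℕ.* length A′) ℕ.≤ ∑ (cartesianProduct S P) incidences
      many = begin
        length A ℕ.* (length A ℕ.* length A′)           ≡⟨ cong (length A ℕ.*_) |Z| ⟨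
        length A ℕ.* length Z                           ≡⟨ ℕ.*-comm (length A) _ ⟩
        length Z ℕ.* length A                           ≡⟨ ∑-const Z _ ⟨
        ∑[ z ∈ Z ] length A                             ≤⟨ ∑-mono-∈ Z rich ⟩
        ∑[ z ∈ Z ] ∑[ s ∈ S ] ∑[ p ∈ P ] 𝟙 (φ s z ≟ p)  ≡⟨ ∑-incidences S P ⟨
        ∑ (cartesianProduct S P) incidences             ∎
        where
        rich : ∀ z → z ∈ Z → length A ℕ.≤ ∑[ s ∈ S ] ∑[ p ∈ P ] 𝟙 (φ s z ≟ p)
        -- For fixed (b , c) the shifts s = a + b are distinct elements of S, and (s - b) · c = a ·
        -- c lies in P because c also belongs to A.
        rich z@(b , c) z∈ with b∈ , c∈ ← ∈-cartesianProduct⁻ A A′ z∈ = begin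
          length A          ≡⟨ trans (∑-const A 1) (ℕ.*-identityʳ _) ⟨
          ∑[ _ ∈ A ] 1      ≤⟨ ∑-injection _≟_ S (_+ b) _ A-unique (∙-cancelʳ b _ _) (λ a a∈ →
                                 ℕ.≤-trans (∑-hit-1 _≟_ (a·c∈P a a∈))
                                           (∑-hit _≟_ _ (A+A⊆S a∈ b∈))) ⟩
          ∑[ s ∈ S ] ∑[ p ∈ P ] 𝟙 (φ s z ≟ p) ∎
          where
          a·c∈P : ∀ a → a ∈ A → φ (a + b) z ∈ P
          a·c∈P a a∈ = subst (λ d → (d · c) ∈ P) (sym (//-rightDividesʳ b a))
                             (A·A⊆P a∈ (proj₁ (∈-filter⁻ (¬? ∘ (_∈? L)) c∈)))

-- Matrices over a finite field

vectors : {X : Set} → List X → ∀ n → List (Vec X n)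
vectors xs zero    = [] ∷ []
vectors xs (suc n) = cartesianProductWith _∷_ xs (vectors xs n)

module _ {X : Set} {xs : List X} where

  length-vectors : ∀ n → length (vectors xs n) ≡ length xs ^ n
  length-vectors zero    = refl
  length-vectors (suc n) = trans (length-cartesianProductWith _∷_ xs (vectors xs n))
                                 (cong (length xs ℕ.*_) (length-vectors n))

  vectors-complete : (∀ x → x ∈ xs) → ∀ {n} (v : Vec X n) → v ∈ vectors xs n
  vectors-complete complete []      = here refl
  vectors-complete complete (x ∷ v) = ∈-cartesianProductWith⁺ _∷_ (complete x) (vectors-complete complete v)

  vectors-unique : Unique xs → ∀ n → Unique (vectors xs n)
  vectors-unique unique zero    = [] ∷ []
  vectors-unique unique (suc n) = Unique.cartesianProductWith⁺ _∷_ Vec.∷-injective unique (vectors-unique unique n)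

zipWith-isAbelianGroup : {X : Set} {_+_ : Op₂ X} {0# : X} { -_ : Op₁ X} → IsAbelianGroup _≡_ _+_ 0# -_ →
  ∀ n → IsAbelianGroup _≡_ (zipWith {n = n} _+_) (Vec.replicate n 0#) (Vec.map -_)
zipWith-isAbelianGroup {_+_ = _+_} G n = record
  { isGroup = record
    { isMonoid = record
      { isSemigroup = record
        { isMagma = record { isEquivalence = isEquivalence ; ∙-cong = cong₂ (zipWith _+_) }
        ; assoc   = Vec.zipWith-assoc assoc }
      ; identity = Vec.zipWith-identityˡ identityˡ , Vec.zipWith-identityʳ identityʳ }
    ; inverse = Vec.zipWith-inverseˡ inverseˡ , Vec.zipWith-inverseʳ inverseʳ
    ; ⁻¹-cong = cong (Vec.map _) }
  ; comm = Vec.zipWith-comm comm }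
  where open IsAbelianGroup G using (assoc; identityˡ; identityʳ; inverseˡ; inverseʳ; comm)

-- This puts the remaining rows in the `punchIn` form used when `sum-remove` takes one index out of
-- a sum.
lookup-removeAt : {X : Set} → ∀ {n} (v : Vec X (suc n)) i k → lookup (removeAt v i) k ≡ lookup v (punchIn i k)
lookup-removeAt v i k = trans (cong (lookup (removeAt v i)) (sym (Fin.punchOut-punchIn i)))
                              (Vec.removeAt-punchOut v (Fin.punchInᵢ≢i i k ∘ sym))

lookup-injective : {X : Set} → ∀ {n} (u v : Vec X n) → (∀ i → lookup u i ≡ lookup v i) → u ≡ v
lookup-injective u v eq = trans (sym (Vec.tabulate∘lookup u)) (trans (Vec.tabulate-cong eq) (Vec.tabulate∘lookup v))

module Matrices (F : FiniteField) where
  open FiniteField F renaming (_+_ to infixl 6 _+_; _*_ to infixl 7 _*_; -_ to infix 8 -_)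

  private
    ring : CommutativeRing _ _
    ring = record { isCommutativeRing = isCommutativeRing }

  open CommutativeRing ring using (+-isAbelianGroup; *-assoc; *-comm; *-identityˡ; +-identityˡ;
                                         distribˡ; distribʳ; zeroʳ; _-_)
  open AbelianGroupProperties (CommutativeRing.+-abelianGroup ring)
    using (x∙y⁻¹≈ε⇒x≈y; inverseˡ-unique; ∙-cancelʳ; //-rightDividesˡ)
  open SemiringSum (CommutativeRing.semiring ring)
    renaming (sum to Sum)

  elements : List Carrier
  elements = map (Inverse.from enum) (allFin size)

  length-elements : length elements ≡ size
  length-elements = trans (length-map (Inverse.from enum) (allFin size)) (length-tabulate id)

  elements-complete : ∀ x → x ∈ elements
  elements-complete x = subst (_∈ elements) (Inverse.strictlyInverseʳ enum x)
                              (∈-map⁺ (Inverse.from enum) (∈-allFin (Inverse.to enum x)))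

  elements-unique : Unique elements
  elements-unique = Unique.map⁺ from-injective (Unique.allFin⁺ size)
    where
    from-injective : ∀ {i j} → Inverse.from enum i ≡ Inverse.from enum j → i ≡ j
    from-injective {i} {j} eq = trans (sym (Inverse.strictlyInverseˡ enum i))
                                (trans (cong (Inverse.to enum) eq) (Inverse.strictlyInverseˡ enum j))

  matrices : ∀ n → List (Mat F n)
  matrices n = vectors (vectors elements n) n

  length-matrices : ∀ n → length (matrices n) ≡ size ^ (n ℕ.* n)
  length-matrices n = begin
    length (matrices n)                     ≡⟨ length-vectors n ⟩
    length (vectors elements n) ^ n         ≡⟨ cong (_^ n) (length-vectors n) ⟩
    (length elements ^ n) ^ n               ≡⟨ cong (λ q → (q ^ n) ^ n) length-elements ⟩
    (size ^ n) ^ n                          ≡⟨ ℕ.^-*-assoc size n n ⟩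
    size ^ (n ℕ.* n)                        ∎
    where open ≡-Reasoning

  +M-isAbelianGroup : ∀ n → IsAbelianGroup _≡_ (_+M_ F {n}) _ _
  +M-isAbelianGroup n = zipWith-isAbelianGroup (zipWith-isAbelianGroup +-isAbelianGroup n) n

  -- It identifies the fold in `_*M_` with the library sum, whose laws then apply to matrix entries.
  foldr-tabulate : ∀ {n} (f : Fin n → Carrier) → Vec.foldr (λ _ → Carrier) _+_ 0# (tabulate f) ≡ Sum f
  foldr-tabulate {zero}  f = refl
  foldr-tabulate {suc n} f = cong (f Fin.zero +_) (foldr-tabulate (f ∘ Fin.suc))

  -- Entrywise description and distributivity of matrix multiplication

  module _ {n : ℕ} where

    infix 10 _⟨_,_⟩
    _⟨_,_⟩ : Mat F n → Fin n → Fin n → Carrier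
    M ⟨ i , j ⟩ = lookup (lookup M i) j

    infixl 6 _⊕_
    infixl 7 _⊗_
    _⊕_ _⊗_ : Mat F n → Mat F n → Mat F n
    _⊕_ = _+M_ F
    _⊗_ = _*M_ F

    *M-tabulate : ∀ M N → M ⊗ N ≡ tabulate λ i → tabulate λ j → Sum λ k → M ⟨ i , k ⟩ * N ⟨ k , j ⟩
    *M-tabulate M N = Vec.tabulate-cong λ i → Vec.tabulate-cong λ j → foldr-tabulate {n} _

    entry-*M : ∀ M N i j → (M ⊗ N) ⟨ i , j ⟩ ≡ Sum λ k → M ⟨ i , k ⟩ * N ⟨ k , j ⟩
    entry-*M M N i j = begin
      (M ⊗ N) ⟨ i , j ⟩            ≡⟨ cong (_⟨ i , j ⟩) (*M-tabulate M N) ⟩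
      (tabulate λ i → tabulate λ j → Sum λ k → M ⟨ i , k ⟩ * N ⟨ k , j ⟩) ⟨ i , j ⟩
                                      ≡⟨ cong (λ r → lookup r j) (Vec.lookup∘tabulate _ i) ⟩
      lookup (tabulate λ j → Sum λ k → M ⟨ i , k ⟩ * N ⟨ k , j ⟩) j
                                      ≡⟨ Vec.lookup∘tabulate _ j ⟩
      (Sum λ k → M ⟨ i , k ⟩ * N ⟨ k , j ⟩) ∎
      where open ≡-Reasoning

    entry-+M : ∀ M N i j → (M ⊕ N) ⟨ i , j ⟩ ≡ M ⟨ i , j ⟩ + N ⟨ i , j ⟩
    entry-+M M N i j = trans (cong (λ r → lookup r j) (Vec.lookup-zipWith _ i M N))
                             (Vec.lookup-zipWith _+_ j (lookup M i) (lookup N i))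

    entries-injective : ∀ {M N} → (∀ i j → M ⟨ i , j ⟩ ≡ N ⟨ i , j ⟩) → M ≡ N
    entries-injective {M} {N} eq = lookup-injective M N λ i → lookup-injective _ _ (eq i)

    *M-distribˡ-+M : _DistributesOverˡ_ _≡_ _⊗_ _⊕_
    *M-distribˡ-+M M N P = entries-injective λ i j → begin
      (M ⊗ (N ⊕ P)) ⟨ i , j ⟩
        ≡⟨ entry-*M M (N ⊕ P) i j ⟩
      (Sum λ k → M ⟨ i , k ⟩ * (N ⊕ P) ⟨ k , j ⟩)
        ≡⟨ sum-cong-≗ (λ k → trans (cong (M ⟨ i , k ⟩ *_) (entry-+M N P k j)) (distribˡ _ _ _)) ⟩
      (Sum λ k → M ⟨ i , k ⟩ * N ⟨ k , j ⟩ + M ⟨ i , k ⟩ * P ⟨ k , j ⟩)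
        ≡⟨ ∑-distrib-+ {n} _ _ ⟩
      (Sum λ k → M ⟨ i , k ⟩ * N ⟨ k , j ⟩) + (Sum λ k → M ⟨ i , k ⟩ * P ⟨ k , j ⟩)
        ≡⟨ cong₂ _+_ (entry-*M M N i j) (entry-*M M P i j) ⟨
      (M ⊗ N) ⟨ i , j ⟩ + (M ⊗ P) ⟨ i , j ⟩
        ≡⟨ entry-+M (M ⊗ N) (M ⊗ P) i j ⟨
      (M ⊗ N ⊕ M ⊗ P) ⟨ i , j ⟩ ∎
      where open ≡-Reasoning

    *M-distribʳ-+M : _DistributesOverʳ_ _≡_ _⊗_ _⊕_
    *M-distribʳ-+M P M N = entries-injective λ i j → begin
      ((M ⊕ N) ⊗ P) ⟨ i , j ⟩
        ≡⟨ entry-*M (M ⊕ N) P i j ⟩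
      (Sum λ k → (M ⊕ N) ⟨ i , k ⟩ * P ⟨ k , j ⟩)
        ≡⟨ sum-cong-≗ (λ k → trans (cong (_* P ⟨ k , j ⟩) (entry-+M M N i k)) (distribʳ _ _ _)) ⟩
      (Sum λ k → M ⟨ i , k ⟩ * P ⟨ k , j ⟩ + N ⟨ i , k ⟩ * P ⟨ k , j ⟩)
        ≡⟨ ∑-distrib-+ {n} _ _ ⟩
      (Sum λ k → M ⟨ i , k ⟩ * P ⟨ k , j ⟩) + (Sum λ k → N ⟨ i , k ⟩ * P ⟨ k , j ⟩)
        ≡⟨ cong₂ _+_ (entry-*M M P i j) (entry-*M N P i j) ⟨
      (M ⊗ P) ⟨ i , j ⟩ + (N ⊗ P) ⟨ i , j ⟩
        ≡⟨ entry-+M (M ⊗ P) (N ⊗ P) i j ⟨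
      (M ⊗ P ⊕ N ⊗ P) ⟨ i , j ⟩ ∎
      where open ≡-Reasoning

  -- Singular matrices: enumeration and cancellation

  module _ (m : ℕ) where

    -- Scaling a nonzero left kernel vector to have j-th coordinate 1 shows that every singular matrix
    -- arises in this way; matrices may repeat, as only the length matters.
    dependent-row : Fin (suc m) × Vec Carrier m × Vec (Vec Carrier (suc m)) m → Mat F (suc m)
    dependent-row (j , v , rows) =
      insertAt rows j (tabulate λ l → - (Sum λ k → lookup v k * lookup (lookup rows k) l))

    row-data : List (Fin (suc m) × Vec Carrier m × Vec (Vec Carrier (suc m)) m)
    row-data = cartesianProduct (allFin (suc m))
                 (cartesianProduct (vectors elements m) (vectors (vectors elements (suc m)) m))

    singular : List (Mat F (suc m))
    singular = map dependent-row row-data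

    -- With n = `suc m`, there are n positions for the dependent row, m coefficients and m free rows
    -- of length n; the exponent m + m n is n² - 1.
    length-singular : length singular ≡ suc m ℕ.* size ^ (m ℕ.+ m ℕ.* suc m)
    length-singular = begin
      length singular
        ≡⟨ length-map dependent-row row-data ⟩
      length row-data
        ≡⟨ length-cartesianProductWith _,_ (allFin (suc m)) (cartesianProduct V R) ⟩
      length (allFin (suc m)) ℕ.* length (cartesianProduct V R)
        ≡⟨ cong₂ ℕ._*_ (length-tabulate {n = suc m} id) (length-cartesianProductWith _,_ V R) ⟩
      suc m ℕ.* (length V ℕ.* length R)
        ≡⟨ cong (suc m ℕ.*_) (cong₂ ℕ._*_ (length-vectors {xs = elements} m)
             (trans (length-vectors {xs = vectors elements (suc m)} m) (cong (_^ m) (length-vectors {xs = elements} (suc m))))) ⟩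
      suc m ℕ.* (length elements ^ m ℕ.* (length elements ^ suc m) ^ m)
        ≡⟨ cong (λ q → suc m ℕ.* (q ^ m ℕ.* (q ^ suc m) ^ m)) length-elements ⟩
      suc m ℕ.* (size ^ m ℕ.* (size ^ suc m) ^ m)
        ≡⟨ cong (λ e → suc m ℕ.* (size ^ m ℕ.* e)) (trans (ℕ.^-*-assoc size (suc m) m)
                                                          (cong (size ^_) (ℕ.*-comm (suc m) m))) ⟩
      suc m ℕ.* (size ^ m ℕ.* size ^ (m ℕ.* suc m))
        ≡⟨ cong (suc m ℕ.*_) (ℕ.^-distribˡ-+-* size m (m ℕ.* suc m)) ⟨
      suc m ℕ.* size ^ (m ℕ.+ m ℕ.* suc m) ∎
      where
      open ≡-Reasoning
      V = vectors elements m
      R = vectors (vectors elements (suc m)) m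

    dependent⇒singular : ∀ {D} (w : Fin (suc m) → Carrier) → (∀ l → (Sum λ k → w k * D ⟨ k , l ⟩) ≡ 0#) →
                         ∀ j → w j ≢ 0# → D ∈ singular
    dependent⇒singular {D} w wD≡0 j wⱼ≢0 with t , wⱼt≡1 ← inverse (w j) wⱼ≢0 =
      subst (_∈ singular) decoded (∈-map⁺ dependent-row
        (∈-cartesianProduct⁺ (∈-allFin j) (∈-cartesianProduct⁺
          (vectors-complete elements-complete v) (vectors-complete (vectors-complete elements-complete) rows))))
      where
      open ≡-Reasoning
      -- The coefficients of the other rows once the j-th coordinate of w is scaled to 1.
      v    = tabulate λ k → t * w (punchIn j k)
      rows = removeAt D j

      lookup-v*row : ∀ l k → t * (w (punchIn j k) * D ⟨ punchIn j k , l ⟩) ≡ lookup v k * lookup (lookup rows k) l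
      lookup-v*row l k = trans (sym (*-assoc t _ _))
        (sym (cong₂ _*_ (Vec.lookup∘tabulate _ k) (cong (λ r → lookup r l) (lookup-removeAt D j k))))

      rowⱼ : ∀ l → D ⟨ j , l ⟩ ≡ - (Sum λ k → lookup v k * lookup (lookup rows k) l)
      -- Row j plus the combination of the other rows is t times the vanishing l-th entry of w D,
      -- with the term at j taken out of the sum.
      rowⱼ l = inverseˡ-unique _ _ (begin
        D ⟨ j , l ⟩ + (Sum λ k → lookup v k * lookup (lookup rows k) l)
          ≡⟨ cong₂ _+_ t*wⱼDⱼ (sum-cong-≗ (lookup-v*row l)) ⟨
        t * (w j * D ⟨ j , l ⟩) + (Sum λ k → t * (w (punchIn j k) * D ⟨ punchIn j k , l ⟩))
          ≡⟨ cong (t * (w j * D ⟨ j , l ⟩) +_) (*-distribˡ-sum {m} t _) ⟨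
        t * (w j * D ⟨ j , l ⟩) + t * (Sum λ k → w (punchIn j k) * D ⟨ punchIn j k , l ⟩)
          ≡⟨ distribˡ t _ _ ⟨
        t * (w j * D ⟨ j , l ⟩ + (Sum λ k → w (punchIn j k) * D ⟨ punchIn j k , l ⟩))
          ≡⟨ cong (t *_) (sum-remove {i = j} (λ k → w k * D ⟨ k , l ⟩)) ⟨
        t * (Sum λ k → w k * D ⟨ k , l ⟩)
          ≡⟨ cong (t *_) (wD≡0 l) ⟩
        t * 0#
          ≡⟨ zeroʳ t ⟩
        0# ∎)
        where
        t*wⱼDⱼ : t * (w j * D ⟨ j , l ⟩) ≡ D ⟨ j , l ⟩
        t*wⱼDⱼ = begin
          t * (w j * D ⟨ j , l ⟩)  ≡⟨ *-assoc t _ _ ⟨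
          t * w j * D ⟨ j , l ⟩    ≡⟨ cong (_* D ⟨ j , l ⟩) (trans (*-comm t (w j)) wⱼt≡1) ⟩
          1# * D ⟨ j , l ⟩         ≡⟨ *-identityˡ _ ⟩
          D ⟨ j , l ⟩              ∎

      decoded : dependent-row (j , v , rows) ≡ D
      decoded = trans (cong (insertAt rows j) (trans (sym (Vec.tabulate-cong rowⱼ)) (Vec.tabulate∘lookup (lookup D j))))
                      (Vec.insertAt-removeAt D j)

    -- If M and N differed at (i , j), row i of M - N would be a left kernel vector of D with
    -- nonzero j-th coordinate, putting D in `singular`.
    nonsingular-cancelʳ : ∀ {D} → D ∉ singular → ∀ {M N} → M ⊗ D ≡ N ⊗ D → M ≡ N
    nonsingular-cancelʳ {D} D∉ {M} {N} MD≡ND = entries-injective entry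
      where
      open ≡-Reasoning
      annihilates : ∀ i l → (Sum λ k → (M ⟨ i , k ⟩ - N ⟨ i , k ⟩) * D ⟨ k , l ⟩) ≡ 0#
      annihilates i l = ∙-cancelʳ (Sum λ k → N ⟨ i , k ⟩ * D ⟨ k , l ⟩) _ _ (begin
        (Sum λ k → (M ⟨ i , k ⟩ - N ⟨ i , k ⟩) * D ⟨ k , l ⟩) + (Sum λ k → N ⟨ i , k ⟩ * D ⟨ k , l ⟩)
          ≡⟨ ∑-distrib-+ {suc m} (λ k → (M ⟨ i , k ⟩ - N ⟨ i , k ⟩) * D ⟨ k , l ⟩) (λ k → N ⟨ i , k ⟩ * D ⟨ k , l ⟩) ⟨
        (Sum λ k → (M ⟨ i , k ⟩ - N ⟨ i , k ⟩) * D ⟨ k , l ⟩ + N ⟨ i , k ⟩ * D ⟨ k , l ⟩)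
          ≡⟨ sum-cong-≗ (λ k → trans (sym (distribʳ (D ⟨ k , l ⟩) _ _))
               (cong (_* D ⟨ k , l ⟩) (//-rightDividesˡ (N ⟨ i , k ⟩) (M ⟨ i , k ⟩)))) ⟩
        (Sum λ k → M ⟨ i , k ⟩ * D ⟨ k , l ⟩)
          ≡⟨ entry-*M M D i l ⟨
        (M ⊗ D) ⟨ i , l ⟩
          ≡⟨ cong (_⟨ i , l ⟩) MD≡ND ⟩
        (N ⊗ D) ⟨ i , l ⟩
          ≡⟨ entry-*M N D i l ⟩
        (Sum λ k → N ⟨ i , k ⟩ * D ⟨ k , l ⟩)
          ≡⟨ +-identityˡ _ ⟨
        0# + (Sum λ k → N ⟨ i , k ⟩ * D ⟨ k , l ⟩) ∎)
      entry : ∀ i j → M ⟨ i , j ⟩ ≡ N ⟨ i , j ⟩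
      entry i j with (M ⟨ i , j ⟩ - N ⟨ i , j ⟩) ≟ 0#
      ... | yes ≡0 = x∙y⁻¹≈ε⇒x≈y _ _ ≡0
      ... | no  ≢0 = ⊥-elim (D∉ (dependent⇒singular (λ k → M ⟨ i , k ⟩ - N ⟨ i , k ⟩) (annihilates i) j ≢0))

-- Passage to ℚ

open import Data.Rational as ℚ using (ℚ; _≤_; _<_; _*_; _⊓_; _⊔_; 0ℚ)

-- `ℕ→ℚ` normalises its fraction, so the comparison passes through unnormalised rationals, where
-- `mkℚᵘ (ℤ.+ m) 0` is plainly m / 1 (the 0 is the denominator minus one).
ℕ→ℚ-mono-≤ : ∀ {m n} → m ℕ.≤ n → ℕ→ℚ m ≤ ℕ→ℚ n
ℕ→ℚ-mono-≤ {m} {n} m≤n = ℚ.toℚᵘ-cancel-≤ (begin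
  ℚ.toℚᵘ (ℕ→ℚ m)    ≃⟨ ℚ.toℚᵘ-fromℚᵘ (mkℚᵘ (ℤ.+ m) 0) ⟩
  mkℚᵘ (ℤ.+ m) 0    ≤⟨ *≤* (ℤ.*-monoʳ-≤-nonNeg (ℤ.+ 1) (ℤ.+≤+ m≤n)) ⟩
  mkℚᵘ (ℤ.+ n) 0    ≃⟨ ℚ.toℚᵘ-fromℚᵘ (mkℚᵘ (ℤ.+ n) 0) ⟨
  ℚ.toℚᵘ (ℕ→ℚ n)    ∎)
  where open ℚᵘ.≤-Reasoning

ℕ→ℚ-cancel-≤ : ∀ {m n} → ℕ→ℚ m ≤ ℕ→ℚ n → m ℕ.≤ n
ℕ→ℚ-cancel-≤ {m} {n} le = ℤ.drop‿+≤+ (ℤ.*-cancelʳ-≤-pos (ℤ.+ m) (ℤ.+ n) (ℤ.+ 1) (ℚᵘ.drop-*≤* (begin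
  mkℚᵘ (ℤ.+ m) 0    ≃⟨ ℚ.toℚᵘ-fromℚᵘ (mkℚᵘ (ℤ.+ m) 0) ⟨
  ℚ.toℚᵘ (ℕ→ℚ m)    ≤⟨ ℚ.toℚᵘ-mono-≤ le ⟩
  ℚ.toℚᵘ (ℕ→ℚ n)    ≃⟨ ℚ.toℚᵘ-fromℚᵘ (mkℚᵘ (ℤ.+ n) 0) ⟩
  mkℚᵘ (ℤ.+ n) 0    ∎)))
  where open ℚᵘ.≤-Reasoning

ℕ→ℚ-* : ∀ m n → ℕ→ℚ (m ℕ.* n) ≡ ℕ→ℚ m * ℕ→ℚ n
ℕ→ℚ-* m n = ℚ.toℚᵘ-injective (begin
  ℚ.toℚᵘ (ℕ→ℚ (m ℕ.* n))                ≈⟨ ℚ.toℚᵘ-fromℚᵘ (mkℚᵘ (ℤ.+ (m ℕ.* n)) 0) ⟩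
  mkℚᵘ (ℤ.+ (m ℕ.* n)) 0                ≈⟨ *≡* (cong (ℤ._* ℤ.+ 1) (ℤ.pos-* m n)) ⟩
  mkℚᵘ (ℤ.+ m) 0 ℚᵘ.* mkℚᵘ (ℤ.+ n) 0    ≈⟨ ℚᵘ.*-cong (ℚ.toℚᵘ-fromℚᵘ (mkℚᵘ (ℤ.+ m) 0)) (ℚ.toℚᵘ-fromℚᵘ (mkℚᵘ (ℤ.+ n) 0)) ⟨
  ℚ.toℚᵘ (ℕ→ℚ m) ℚᵘ.* ℚ.toℚᵘ (ℕ→ℚ n)    ≈⟨ ℚ.toℚᵘ-homo-* (ℕ→ℚ m) (ℕ→ℚ n) ⟨
  ℚ.toℚᵘ (ℕ→ℚ m * ℕ→ℚ n)                ∎)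
  where open ℚᵘ.≃-Reasoning

ℕ→ℚ-nonNeg : ∀ n → ℚ.NonNegative (ℕ→ℚ n)
ℕ→ℚ-nonNeg n = ℚ.normalize-nonNeg n 1

ℕ→ℚ-pos : ∀ n .{{_ : ℕ.NonZero n}} → ℚ.Positive (ℕ→ℚ n)
ℕ→ℚ-pos n = ℚ.normalize-pos n 1

-- One factor c cancels κ; the other is at most 1 and only shrinks the left side. Thus c = 1/κ
-- serves in the squared inequality without a square root.
absorb-constant : ∀ c κ x W .{{_ : ℚ.NonNegative c}} .{{_ : ℚ.NonNegative W}} →
  c * κ ≡ ℚ.1ℚ → c ≤ ℚ.1ℚ → x ≤ κ * W → c * c * x ≤ W
absorb-constant c κ x W cκ≡1 c≤1 x≤κW = begin
  c * c * x          ≡⟨ ℚ.*-assoc c c x ⟩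
  c * (c * x)        ≤⟨ ℚ.*-monoˡ-≤-nonNeg c (ℚ.*-monoˡ-≤-nonNeg c x≤κW) ⟩
  c * (c * (κ * W))  ≡⟨ cong (c *_) (trans (sym (ℚ.*-assoc c κ W)) (cong (_* W) cκ≡1)) ⟩
  c * (ℚ.1ℚ * W)     ≡⟨ cong (c *_) (ℚ.*-identityˡ W) ⟩
  c * W              ≤⟨ ℚ.*-monoʳ-≤-nonNeg W c≤1 ⟩
  ℚ.1ℚ * W           ≡⟨ ℚ.*-identityˡ W ⟩
  W                  ∎
  where open ℚ.≤-Reasoning

⊔-nonNeg : ∀ m n → ℚ.NonNegative (ℕ→ℚ m ⊔ ℕ→ℚ n)
⊔-nonNeg m n = ℚ.nonNegative (ℚ.≤-trans (ℚ.nonNegative⁻¹ (ℕ→ℚ m) {{ℕ→ℚ-nonNeg m}}) (ℚ.p≤p⊔q (ℕ→ℚ m) (ℕ→ℚ n)))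

max²-nonNeg : ∀ m n k → ℚ.NonNegative ((ℕ→ℚ m ⊔ ℕ→ℚ n) * (ℕ→ℚ m ⊔ ℕ→ℚ n) * ℕ→ℚ k)
max²-nonNeg m n k = ℚ.nonNeg*nonNeg⇒nonNeg (M * M) {{ℚ.nonNeg*nonNeg⇒nonNeg M {{⊔-nonNeg m n}} M {{⊔-nonNeg m n}}}}
                                           (ℕ→ℚ k) {{ℕ→ℚ-nonNeg k}}
  where M = ℕ→ℚ m ⊔ ℕ→ℚ n

abstract
  -- The bound c ≤ 1 comes from K ≥ 1. Later steps rely on these properties alone, and `abstract`
  -- keeps the quotient from unfolding.
  reciprocal : ∀ K .{{_ : ℕ.NonZero K}} → ∃[ c ] (0ℚ < c × c ≤ ℚ.1ℚ × c * ℕ→ℚ K ≡ ℚ.1ℚ)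
  reciprocal K@(suc _) = c , ℚ.positive⁻¹ c , c≤1 , ℚ.*-inverseˡ (ℕ→ℚ K)
    where
    instance
      K-pos : ℚ.Positive (ℕ→ℚ K)
      K-pos = ℕ→ℚ-pos K
      K≢0 : ℚ.NonZero (ℕ→ℚ K)
      K≢0 = ℚ.pos⇒nonZero (ℕ→ℚ K)
    c : ℚ
    c = ℚ.1/ ℕ→ℚ K
    instance
      c-pos : ℚ.Positive c
      c-pos = ℚ.1/pos⇒pos (ℕ→ℚ K)
      c-nonNeg : ℚ.NonNegative c
      c-nonNeg = ℚ.pos⇒nonNeg c

    c≤1 : c ≤ ℚ.1ℚ
    c≤1 = begin
      c            ≡⟨ ℚ.*-identityʳ c ⟨
      c * ℚ.1ℚ     ≤⟨ ℚ.*-monoˡ-≤-nonNeg c (ℕ→ℚ-mono-≤ {1} {K} (s≤s z≤n)) ⟩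
      c * ℕ→ℚ K    ≡⟨ ℚ.*-inverseˡ (ℕ→ℚ K) ⟩
      ℚ.1ℚ         ∎
      where open ℚ.≤-Reasoning

-- The product s p is at most the square of the maximum, and the minimum is at most whichever of its
-- two terms is controlled.
min-bound : ∀ {c} K s p Z X Y a → 0ℚ < c → c ≤ ℚ.1ℚ → c * ℕ→ℚ K ≡ ℚ.1ℚ →
  X ℕ.* a ℕ.≤ K ℕ.* (s ℕ.* p ℕ.* Z) ⊎ Y ℕ.≤ K ℕ.* (s ℕ.* p ℕ.* Z) →
  c * c * (ℕ→ℚ Y ⊓ (ℕ→ℚ X * ℕ→ℚ a)) ≤ (ℕ→ℚ s ⊔ ℕ→ℚ p) * (ℕ→ℚ s ⊔ ℕ→ℚ p) * ℕ→ℚ Z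
min-bound {c} K s p Z X Y a c>0 c≤1 cK≡1 small =
    absorb-constant c (ℕ→ℚ K) _ W {{ℚ.nonNegative (ℚ.<⇒≤ c>0)}} {{max²-nonNeg s p Z}} cK≡1 c≤1 (min≤ small)
  where
  open ℚ.≤-Reasoning
  M = ℕ→ℚ s ⊔ ℕ→ℚ p
  W = M * M * ℕ→ℚ Z

  scale : ∀ {x} → x ℕ.≤ K ℕ.* (s ℕ.* p ℕ.* Z) → ℕ→ℚ x ≤ ℕ→ℚ K * W
  scale {x} x≤ = begin
    ℕ→ℚ x                              ≤⟨ ℕ→ℚ-mono-≤ x≤ ⟩
    ℕ→ℚ (K ℕ.* (s ℕ.* p ℕ.* Z))        ≡⟨ ℕ→ℚ-* K _ ⟩
    ℕ→ℚ K * ℕ→ℚ (s ℕ.* p ℕ.* Z)        ≡⟨ cong (ℕ→ℚ K *_) (trans (ℕ→ℚ-* (s ℕ.* p) Z) (cong (_* ℕ→ℚ Z) (ℕ→ℚ-* s p))) ⟩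
    ℕ→ℚ K * (ℕ→ℚ s * ℕ→ℚ p * ℕ→ℚ Z)    ≤⟨ ℚ.*-monoˡ-≤-nonNeg (ℕ→ℚ K) {{ℕ→ℚ-nonNeg K}} (ℚ.*-monoʳ-≤-nonNeg (ℕ→ℚ Z) {{ℕ→ℚ-nonNeg Z}} sp≤M²) ⟩
    ℕ→ℚ K * W                          ∎
    where
    sp≤M² : ℕ→ℚ s * ℕ→ℚ p ≤ M * M
    sp≤M² = begin
      ℕ→ℚ s * ℕ→ℚ p   ≤⟨ ℚ.*-monoˡ-≤-nonNeg (ℕ→ℚ s) {{ℕ→ℚ-nonNeg s}} (ℚ.p≤q⊔p (ℕ→ℚ s) (ℕ→ℚ p)) ⟩
      ℕ→ℚ s * M       ≤⟨ ℚ.*-monoʳ-≤-nonNeg M {{⊔-nonNeg s p}} (ℚ.p≤p⊔q (ℕ→ℚ s) (ℕ→ℚ p)) ⟩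
      M * M           ∎

  min≤ : X ℕ.* a ℕ.≤ K ℕ.* (s ℕ.* p ℕ.* Z) ⊎ Y ℕ.≤ K ℕ.* (s ℕ.* p ℕ.* Z) →
         ℕ→ℚ Y ⊓ (ℕ→ℚ X * ℕ→ℚ a) ≤ ℕ→ℚ K * W
  min≤ (inj₁ Xa≤) = ℚ.≤-trans (ℚ.p⊓q≤q (ℕ→ℚ Y) _) (subst (_≤ ℕ→ℚ K * W) (ℕ→ℚ-* X a) (scale Xa≤))
  min≤ (inj₂ Y≤)  = ℚ.≤-trans (ℚ.p⊓q≤p (ℕ→ℚ Y) _) (scale Y≤)

-- The sum-product bound for matrices

module _ (F : FiniteField) where
  open FiniteField F using (size)
  open Matrices F

  ∈-pairwise : ∀ {n} (_∘_ : Mat F n → Mat F n → Mat F n) {A x y} → x ∈ A → y ∈ A →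
               (x ∘ y) ∈ deduplicate (_≟M_ F) (pairwise F _∘_ A)
  ∈-pairwise _∘_ {A} {x} {y} x∈A y∈A = ∈-deduplicate⁺ (_≟M_ F)
    (∈-concatMap⁺ (λ a → map (a ∘_) A) (Any.map (λ { refl → ∈-map⁺ (x ∘_) y∈A }) x∈A))

  -- Multiplying the first alternative Q a ≤ 2 τ by q^(2n²-1) gives both alternatives the same right
  -- side. The factor 8 n comes from the error term and dominates the 2 of the main term.
  matrix-sum-product : ∀ m (A : List (Mat F (suc m))) → Unique A →
    let N = suc m ℕ.* suc m
        K = 8 ℕ.* suc m
        τ = sumsetSize F A ℕ.* prodsetSize F A
    in 2 ℕ.* suc m ℕ.* size ^ (N ∸ 1) ℕ.≤ length A →
       size ^ (3 ℕ.* N ∸ 1) ℕ.* length A ℕ.≤ K ℕ.* (τ ℕ.* size ^ (2 ℕ.* N ∸ 1))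
         ⊎ length A ^ 4 ℕ.≤ K ℕ.* (τ ℕ.* size ^ (2 ℕ.* N ∸ 1))
  matrix-sum-product m A A-unique large = Sum.map main-term error-term
    (sum-product A-unique _ _ (DecUnique.deduplicate-! (_≟M_ F) _) (DecUnique.deduplicate-! (_≟M_ F) _)
      (∈-pairwise (_+M_ F)) (∈-pairwise (_*M_ F))
      -- The size hypothesis is exactly 2 |`singular`| ≤ |A|, which is the source of C₀ = 2 n.
      (subst (ℕ._≤ length A) (trans (ℕ.*-assoc 2 (suc m) _) (cong (2 ℕ.*_) (sym (length-singular m)))) large))
    where
    open ℕ.≤-Reasoning
    open SumProduct (_≟M_ F) (+M-isAbelianGroup (suc m)) *M-distribˡ-+M *M-distribʳ-+M
      (matrices (suc m)) (vectors-unique (vectors-unique elements-unique (suc m)) (suc m))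
      (vectors-complete (vectors-complete elements-complete)) (singular m) (nonsingular-cancelʳ m)
    -- `suc m ℕ.* suc m` computes to `suc N-1`, so the truncated subtractions in the exponents
    -- reduce by themselves.
    N-1 = m ℕ.+ m ℕ.* suc m
    N = suc N-1
    a = length A
    Q = size ^ N
    L = size ^ N-1
    τ = sumsetSize F A ℕ.* prodsetSize F A
    |U| = length-matrices (suc m)

    2N∸1 : size ^ (2 ℕ.* N ∸ 1) ≡ L ℕ.* Q
    2N∸1 = trans (ℕ.^-distribˡ-+-* size N-1 (N ℕ.+ 0)) (cong (λ e → L ℕ.* size ^ e) (ℕ.+-identityʳ N))

    3N∸1 : size ^ (3 ℕ.* N ∸ 1) ≡ L ℕ.* (Q ℕ.* Q)
    3N∸1 = trans (ℕ.^-distribˡ-+-* size N-1 (N ℕ.+ (N ℕ.+ 0))) (cong (L ℕ.*_)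
      (trans (ℕ.^-distribˡ-+-* size N (N ℕ.+ 0)) (cong (λ e → Q ℕ.* size ^ e) (ℕ.+-identityʳ N))))

    main-term : length (matrices (suc m)) ℕ.* a ℕ.≤ 2 ℕ.* τ →
                size ^ (3 ℕ.* N ∸ 1) ℕ.* a ℕ.≤ 8 ℕ.* suc m ℕ.* (τ ℕ.* size ^ (2 ℕ.* N ∸ 1))
    main-term Ua≤2τ = begin
      size ^ (3 ℕ.* N ∸ 1) ℕ.* a                           ≡⟨ cong (ℕ._* a) 3N∸1 ⟩
      L ℕ.* (Q ℕ.* Q) ℕ.* a                                ≡⟨ regroup L Q a ⟩
      Q ℕ.* a ℕ.* (L ℕ.* Q)                                ≤⟨ ℕ.*-monoˡ-≤ (L ℕ.* Q) (subst (λ u → u ℕ.* a ℕ.≤ 2 ℕ.* τ) |U| Ua≤2τ) ⟩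
      2 ℕ.* τ ℕ.* (L ℕ.* Q)                                ≡⟨ ℕ.*-assoc 2 τ _ ⟩
      2 ℕ.* (τ ℕ.* (L ℕ.* Q))                              ≤⟨ ℕ.*-monoˡ-≤ (τ ℕ.* (L ℕ.* Q)) 2≤8n ⟩
      8 ℕ.* suc m ℕ.* (τ ℕ.* (L ℕ.* Q))                    ≡⟨ cong (λ z → 8 ℕ.* suc m ℕ.* (τ ℕ.* z)) 2N∸1 ⟨
      8 ℕ.* suc m ℕ.* (τ ℕ.* size ^ (2 ℕ.* N ∸ 1))         ∎
      where
      regroup : ∀ L Q a → L ℕ.* (Q ℕ.* Q) ℕ.* a ≡ Q ℕ.* a ℕ.* (L ℕ.* Q)
      regroup = solve-∀
      2≤8n : 2 ℕ.≤ 8 ℕ.* suc m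
      2≤8n = ℕ.≤-trans (ℕ.m≤m+n 2 6) (ℕ.m≤m*n 8 (suc m))

    error-term : a ^ 4 ℕ.≤ 8 ℕ.* τ ℕ.* (length (matrices (suc m)) ℕ.* length (singular m)) →
                 a ^ 4 ℕ.≤ 8 ℕ.* suc m ℕ.* (τ ℕ.* size ^ (2 ℕ.* N ∸ 1))
    error-term a⁴≤ = begin
      a ^ 4                                                       ≤⟨ a⁴≤ ⟩
      8 ℕ.* τ ℕ.* (length (matrices (suc m)) ℕ.* length (singular m)) ≡⟨ cong₂ (λ u l → 8 ℕ.* τ ℕ.* (u ℕ.* l)) |U| (length-singular m) ⟩
      8 ℕ.* τ ℕ.* (Q ℕ.* (suc m ℕ.* L))                           ≡⟨ regroup (suc m) τ Q L ⟩
      8 ℕ.* suc m ℕ.* (τ ℕ.* (L ℕ.* Q))                           ≡⟨ cong (λ z → 8 ℕ.* suc m ℕ.* (τ ℕ.* z)) 2N∸1 ⟨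
      8 ℕ.* suc m ℕ.* (τ ℕ.* size ^ (2 ℕ.* N ∸ 1))                ∎
      where
      regroup : ∀ n τ Q L → 8 ℕ.* τ ℕ.* (Q ℕ.* (n ℕ.* L)) ≡ 8 ℕ.* n ℕ.* (τ ℕ.* (L ℕ.* Q))
      regroup = solve-∀

-- The inequality is squared and multiplied by q^(2n²-1), which removes the half-integral exponents
-- and the division: the two terms of the minimum become |A|⁴ and q^(3n²-1) |A|. All quantities are
-- nonnegative, so this is equivalent to the original form.
theorem1p14 : (n : ℕ) → 1 ℕ.≤ n →
    ∃[ C₀ ] ∃[ c ] (0ℚ < C₀ × 0ℚ < c ×
    ((F : FiniteField) → Odd (FiniteField.size F) → IsPrimePower (FiniteField.size F) →
    (A : List (Mat F n)) → Unique A →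
    C₀ * ℕ→ℚ (FiniteField.size F ^ (n ℕ.* n ∸ 1)) ≤ ℕ→ℚ (length A) →
    (c * c) * (ℕ→ℚ (length A ^ 4) ⊓ (ℕ→ℚ (FiniteField.size F ^ (3 ℕ.* (n ℕ.* n) ∸ 1)) * ℕ→ℚ (length A)))
    ≤ ((ℕ→ℚ (sumsetSize F A) ⊔ ℕ→ℚ (prodsetSize F A)) * (ℕ→ℚ (sumsetSize F A) ⊔ ℕ→ℚ (prodsetSize F A)))
    * ℕ→ℚ (FiniteField.size F ^ (2 ℕ.* (n ℕ.* n) ∸ 1))))
theorem1p14 (suc m) _ =
    -- The constants are C₀ = 2 n and c = 1 / (8 n), chosen before the field and the set A.
    ℕ→ℚ (2 ℕ.* suc m) , proj₁ c , ℚ.positive⁻¹ (ℕ→ℚ (2 ℕ.* suc m)) {{ℕ→ℚ-pos (2 ℕ.* suc m)}} , proj₁ (proj₂ c) ,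
    λ F _ _ A A-unique large →
      let q = FiniteField.size F
          N = suc m ℕ.* suc m
      in min-bound (8 ℕ.* suc m) (sumsetSize F A) (prodsetSize F A)
           (q ^ (2 ℕ.* N ∸ 1)) (q ^ (3 ℕ.* N ∸ 1)) (length A ^ 4) (length A)
           (proj₁ (proj₂ c)) (proj₁ (proj₂ (proj₂ c))) (proj₂ (proj₂ (proj₂ c)))
           (matrix-sum-product F m A A-unique
             (ℕ→ℚ-cancel-≤ {2 ℕ.* suc m ℕ.* q ^ (N ∸ 1)} {length A}
               (subst (_≤ ℕ→ℚ (length A)) (sym (ℕ→ℚ-* (2 ℕ.* suc m) (q ^ (N ∸ 1)))) large)))
  where c = reciprocal (8 ℕ.* suc m)
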